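{- Let $G$ be a finite simple graph on the vertex set $\{v_1,\ldots,v_n\}$, let $A_G$ be its vertex-edge incidence matrix, let $E_n$ be the $n\times n$ identity matrix, and let $\overline{A_G}=(\,2E_n\mid A_G\,)$. Let $K$ be a field. Then the following conditions are equivalent: (i) $G$ is strongly chordal; (ii) the toric ideal $I_{\overline{A_G}}$ has a quadratic Gröbner basis; (iii) the toric ideal $I_{\overline{A_G}}$ is generated by quadratic binomials.
   Context: The vertex-edge incidence matrix $A_G$ is the $n\times|E(G)|$ matrix whose column for the edge $\{v_i,v_j\}$ is $\mathbf{e}_i+\mathbf{e}_j$. For an integer matrix $A=(\mathbf{a}_1,\ldots,\mathbf{a}_m)$ the toric ideal $I_A\subset K[y_1,\ldots,y_m]$ is generated by all binomials $\prod_{b_i>0}y_i^{b_i}-\prod_{b_j<0}y_j^{ -b_j}$ with $\mathbf{b}\in\mathbb{Z}^m$, $A\mathbf{b}=\mathbf{0}$. A vertex $v$ is simplicial in a graph if its neighbours form a clique. An ordering $v_1,\ldots,v_n$ of the vertices is a perfect elimination ordering if for each $i<n$, $v_i$ is simplicial in the induced subgraph on $v_i,\ldots,v_n$; it is a strong perfect elimination ordering if in addition, whenever $i<j<k<\ell$ and $\{v_i,v_k\},\{v_i,v_\ell\},\{v_j,v_k\}\in E(G)$, then $\{v_j,v_\ell\}\in E(G)$. $G$ is strongly chordal if it has a strong perfect elimination ordering. "Has a quadratic Gröbner basis" means there is a monomial order with respect to which the ideal has a Gröbner basis consisting of binomials of degree $2$. -}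

module Defs where

open import Level using (Level; _⊔_) renaming (suc to lsuc)
open import Data.Nat as ℕ using (ℕ; zero; suc; _≤_)
open import Data.Integer as ℤ using (ℤ; +_; -[1+_])
open import Data.Fin as Fin using (Fin; splitAt; _<_)
open import Data.Vec as Vec using (Vec; []; _∷_; zipWith; lookup)
open import Data.Vec.Properties using (≡-dec)
open import Data.List as List using (List; []; _∷_; _++_; concatMap)
open import Data.List.Membership.Propositional using (_∈_)
open import Data.List.Relation.Unary.All using (All)
open import Data.List.Relation.Unary.Any using (Any)
open import Data.List.Relation.Unary.Unique.Propositional using (Unique)
open import Data.Product using (Σ; ∃; _×_; _,_; proj₁; proj₂)
open import Data.Sum using (_⊎_; [_,_]′)
open import Function using (_∘_)
open import Function.Bundles using (_↔_; Inverse)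
open import Relation.Nullary using (¬_; yes; no)
open import Relation.Binary.PropositionalEquality using (_≡_)
open import Relation.Binary.Definitions using (Trichotomous)
open import Relation.Binary.Structures using (IsStrictTotalOrder)
open import Induction.WellFounded using (WellFounded)
open import Algebra.Bundles using (CommutativeRing)

record Field (c ℓ : Level) : Set (lsuc (c ⊔ ℓ)) where
  field
    commutativeRing : CommutativeRing c ℓ
  open CommutativeRing commutativeRing public
  field
    0≉1     : ¬ (0# ≈ 1#)
    inverse : ∀ x → ¬ (x ≈ 0#) → Σ Carrier (λ y → (x * y) ≈ 1#)

record SimpleGraph (n : ℕ) : Set where
  field
    edges    : List (Fin n × Fin n)
    ordered  : All (λ e → proj₁ e < proj₂ e) edges
    distinct : Unique edges

  m : ℕ
  m = List.length edges

  edge : Fin m → Fin n × Fin n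
  edge = List.lookup edges

  Adj : Fin n → Fin n → Set
  Adj u v = ((u , v) ∈ edges) ⊎ ((v , u) ∈ edges)

open SimpleGraph public

-- (Strong) perfect elimination orderings.  An ordering v_1,...,v_n is a
-- bijection σ : Fin n ↔ Fin n, position i ↦ vertex σ i.

module _ {n : ℕ} (G : SimpleGraph n) (σ : Fin n ↔ Fin n) where
  private
    v : Fin n → Fin n
    v = Inverse.to σ
    A : Fin n → Fin n → Set
    A i j = Adj G (v i) (v j)

  IsPerfectEliminationOrdering : Set
  IsPerfectEliminationOrdering =
    ∀ i j k → i < j → i < k → ¬ (j ≡ k) → A i j → A i k → A j k

  IsStrongPerfectEliminationOrdering : Set
  IsStrongPerfectEliminationOrdering =
    IsPerfectEliminationOrdering ×
    (∀ i j k l → i < j → j < k → k < l →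
       A i k → A i l → A j k → A j l)

StronglyChordal : ∀ {n} → SimpleGraph n → Set
StronglyChordal {n} G =
  Σ (Fin n ↔ Fin n) (IsStrongPerfectEliminationOrdering G)

∑ : ∀ {N} → (Fin N → ℤ) → ℤ
∑ {zero}  f = + 0
∑ {suc N} f = f Fin.zero ℤ.+ ∑ (f ∘ Fin.suc)

-- a matrix with n rows and N columns, given by its columns
Matrix : ℕ → ℕ → Set
Matrix n N = Fin N → Fin n → ℤ

InKernel : ∀ {n N} → Matrix n N → (Fin N → ℤ) → Set
InKernel {n} M b = ∀ (r : Fin n) → ∑ (λ c → M c r ℤ.* b c) ≡ + 0

unit : ∀ {n} → Fin n → Fin n → ℤ
unit i r with i Fin.≟ r
... | yes _ = + 1
... | no  _ = + 0

incidence : ∀ {n} (G : SimpleGraph n) → Matrix n (m G)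
incidence G c r = unit (proj₁ (edge G c)) r ℤ.+ unit (proj₂ (edge G c)) r

extendedIncidence : ∀ {n} (G : SimpleGraph n) → Matrix n (n ℕ.+ m G)
extendedIncidence {n} G c r =
  [ (λ i → + 2 ℤ.* unit i r) , (λ e → incidence G e r) ]′ (splitAt n c)

-- Polynomials over a field in N variables y_1..y_N.
-- A monomial is its exponent vector; a polynomial is a finite formal sum
-- (list of terms), compared coefficientwise.

Monomial : ℕ → Set
Monomial N = Vec ℕ N

deg : ∀ {N} → Monomial N → ℕ
deg = Vec.sum

_∣ₘ_ : ∀ {N} → Monomial N → Monomial N → Set
α ∣ₘ β = ∀ i → lookup α i ≤ lookup β i

module Polynomials {c ℓ} (K : Field c ℓ) (N : ℕ) where
  open Field K

  Poly : Set c
  Poly = List (Carrier × Monomial N)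

  coeff : Poly → Monomial N → Carrier
  coeff []             α = 0#
  coeff ((a , β) ∷ p)  α with ≡-dec ℕ._≟_ β α
  ... | yes _ = a + coeff p α
  ... | no  _ = coeff p α

  _≈ₚ_ : Poly → Poly → Set ℓ
  p ≈ₚ q = ∀ α → coeff p α ≈ coeff q α

  0ₚ : Poly
  0ₚ = []

  _+ₚ_ : Poly → Poly → Poly
  _+ₚ_ = _++_

  -ₚ_ : Poly → Poly
  -ₚ_ = List.map (λ t → (- proj₁ t , proj₂ t))

  _*ₚ_ : Poly → Poly → Poly
  p *ₚ q = concatMap (λ s → List.map (λ t →
             (proj₁ s * proj₁ t , zipWith ℕ._+_ (proj₂ s) (proj₂ t))) q) p

  mono : Monomial N → Poly
  mono α = (1# , α) ∷ []

  binom : Monomial N → Monomial N → Poly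
  binom u v = mono u +ₚ (-ₚ mono v)

  combo : List (Poly × Poly) → Poly
  combo []            = 0ₚ
  combo ((h , g) ∷ l) = (h *ₚ g) +ₚ combo l

  InIdeal : ∀ {s} → (Poly → Set s) → Poly → Set (c ⊔ ℓ ⊔ s)
  InIdeal S f = Σ (List (Poly × Poly)) λ l →
                  All (S ∘ proj₂) l × (f ≈ₚ combo l)

  IsQuadraticBinomial : Poly → Set ℓ
  IsQuadraticBinomial g = Σ (Monomial N) λ u → Σ (Monomial N) λ v →
    deg u ≡ 2 × deg v ≡ 2 × (g ≈ₚ binom u v)

  record MonomialOrder : Set₁ where
    field
      _≺_         : Monomial N → Monomial N → Set
      isStrictTotalOrder : IsStrictTotalOrder _≡_ _≺_
      wellFounded : WellFounded _≺_
      compatible  : ∀ α β γ → α ≺ β →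
                    zipWith ℕ._+_ α γ ≺ zipWith ℕ._+_ β γ

  module _ (O : MonomialOrder) where
    open MonomialOrder O

    IsInitial : Poly → Monomial N → Set ℓ
    IsInitial f α = ¬ (coeff f α ≈ 0#) ×
      (∀ β → ¬ (coeff f β ≈ 0#) → (β ≡ α) ⊎ (β ≺ α))

    -- Gb is a Gröbner basis of the ideal I (given by its membership
    -- predicate): Gb ⊆ I and in(I) = ⟨in(g) : g ∈ Gb⟩, i.e. the initial
    -- monomial of every nonzero f ∈ I is divisible by some in(g), g ∈ Gb.
    IsGroebnerBasis : ∀ {s} → (Poly → Set s) → List Poly → Set (c ⊔ ℓ ⊔ s)
    IsGroebnerBasis I Gb = All I Gb ×
      (∀ f → I f → ∀ α → IsInitial f α →
         Any (λ g → Σ (Monomial N) λ β → IsInitial g β × (β ∣ₘ α)) Gb)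

posPart negPart : ℤ → ℕ
posPart (+ k)      = k
posPart -[1+ k ]   = 0
negPart (+ k)      = 0
negPart -[1+ k ]   = suc k

module Toric {c ℓ} (K : Field c ℓ) {n N : ℕ} (A : Matrix n N) where
  open Polynomials K N public

  kernelBinomial : (Fin N → ℤ) → Poly
  kernelBinomial b = binom (Vec.tabulate (posPart ∘ b))
                           (Vec.tabulate (negPart ∘ b))

  ToricGenerator : Poly → Set ℓ
  ToricGenerator g = Σ (Fin N → ℤ) λ b → InKernel A b × (g ≈ₚ kernelBinomial b)

  ToricIdeal : Poly → Set (c ⊔ ℓ)
  ToricIdeal = InIdeal ToricGenerator

  HasQuadraticGroebnerBasis : Set (lsuc Level.zero ⊔ c ⊔ ℓ)
  HasQuadraticGroebnerBasis =
    Σ MonomialOrder λ O → Σ (List Poly) λ Gb →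
      All IsQuadraticBinomial Gb × IsGroebnerBasis O ToricIdeal Gb

  GeneratedByQuadraticBinomials : Set (c ⊔ ℓ)
  GeneratedByQuadraticBinomials =
    ∀ f → ToricIdeal f →
      InIdeal (λ g → IsQuadraticBinomial g × ToricIdeal g) f

{-# OPTIONS --safe #-}
module Submission where

open import Defs
open import Data.Nat using (ℕ)
open import Data.Product using (_×_)
open import Function.Bundles using (_⇔_)

import Algebra.Properties.CommutativeSemigroup
import Algebra.Properties.Ring
open import Data.Bool.Base using (Bool; true; false; if_then_else_)
open import Data.Empty using (⊥; ⊥-elim)
open import Data.Fin as Fin using (Fin; zero; suc; toℕ; splitAt; _↑ˡ_; _↑ʳ_)
open import Data.Fin.Induction using (>-wellFounded)
import Data.Fin.Permutation as Perm
open import Data.Fin.Permutation using (_⟨$⟩ʳ_; _⟨$⟩ˡ_; _∘ₚ_; transpose; inverseˡ; inverseʳ)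
import Data.Fin.Permutation.Components as PC
import Data.Fin.Properties as Finₚ
open import Data.Integer as ℤ using (ℤ; -[1+_]) renaming (+_ to infix 8 +ℤ_)
import Data.Integer.Properties as ℤₚ
open import Data.List as List using (List; []; _∷_; _++_; length)
import Data.List.Membership.DecPropositional as DecMembership
open import Data.List.Membership.Propositional using (_∈_; find; lose)
open import Data.List.Membership.Propositional.Properties using (∈-allFin; ∈-cartesianProduct⁺; ∈-filter⁺; ∈-lookup; ∈-map⁺; ∈-map⁻)
open import Data.List.Relation.Unary.All as All using (All; []; _∷_)
import Data.List.Relation.Unary.All.Properties as Allₚ
open import Data.List.Relation.Unary.AllPairs as AllPairs using (AllPairs; []; _∷_)
import Data.List.Relation.Unary.AllPairs.Properties as AllPairsₚ
open import Data.List.Relation.Unary.Any as Any using (Any; here; there; index)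
open import Data.List.Relation.Unary.Any.Properties using (lookup-index)
open import Data.List.Relation.Unary.Unique.Propositional using (Unique)
open import Data.Nat as ℕ using (zero; suc; z≤n; s≤s)
open import Data.Nat.Induction using (<-wellFounded)
import Data.Nat.Properties as ℕₚ
open import Data.Nat.Tactic.RingSolver using (solve-∀)
open import Data.Product using (Σ; ∃; _,_; proj₁; proj₂; uncurry)
import Data.Product.Properties as Productₚ
open import Data.Product.Relation.Binary.Lex.Strict using (×-wellFounded)
open import Data.Sum as Sum using (_⊎_; inj₁; inj₂; fromInj₂; [_,_]′)
open import Data.Vec as Vec using ([]; _∷_; zipWith; lookup)
import Data.Vec.Properties as Vecₚ
open import Function using (_∘_; id)
open import Function.Bundles using (_↔_; mk⇔)
open import Induction.WellFounded using (Acc; acc; WellFounded)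
open import Level using (_⊔_)
import Relation.Binary.Construct.On as On
open import Relation.Binary.Construct.Closure.ReflexiveTransitive using (Star; ε; _◅_; _◅◅_; reverse)
open import Relation.Binary.Definitions using (DecidableEquality; Symmetric; Trichotomous; tri<; tri≈; tri>)
open import Relation.Binary.PropositionalEquality as ≡ using (_≡_; _≢_)
import Relation.Binary.Reasoning.Setoid
open import Relation.Binary.Structures using (IsStrictTotalOrder)
open import Relation.Nullary using (¬_; Dec; yes; no; does; proof; contradiction; Reflects; invert)
open import Relation.Nullary.Decidable using (_×-dec_; _⊎-dec_; ¬?; dec-true; dec-false; decidable-stable; does-⇔)
open import Relation.Unary using (Decidable)

-- Equality in K is not assumed decidable, so polynomials are only probed by linear functionals
-- that depend decidably on monomials.  Call the fiber of a monomial the set of monomials with the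
-- same image under the matrix; quadratic binomials of the toric ideal are moves inside fibers that
-- exchange two variables for two others.
--
-- (ii) ⇒ connected fibers ⇔ (iii), for every integer matrix: a quadratic Gröbner basis reduces
-- the larger of two monomials of a fiber by a move, and a combination of quadratic binomials
-- representing u − v is a union of moves joining u to v.
--
-- (i) ⇒ (ii): identify vertices with their positions in a strong perfect elimination ordering and
-- give the variable of {i , j} (a loop for i = j) the weight n² − i j.  If two monomials of a
-- fiber differ, take the lexicographically first {i , j} in which they do; the one with fewer
-- copies of it contains {i , k} and {j , l} with j < k and i < l, the ordering makes {k , l} an edge,
-- and replacing {i , k}, {j , l} by {i , j}, {k , l} lowers the weight by (k − j)(l − i).  Hence
-- every fiber has a single irreducible monomial.
--
-- Connected fibers ⇒ (i): order the vertices so as to maximize ∑ B i j 2^i 2^j, B being the adjacency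
-- matrix with ones on the diagonal; then the rows of B increase lexicographically, the last column
-- being most significant.  From a violation of the strong elimination property maximal
-- lexicographic differences grow a path that closes up to a chordless cycle or to a sun, and both
-- give a fiber with at least two elements, one of which admits no quadratic move.

-- Polynomials and linear functionals

infixl 6 _⊕_
_⊕_ : ∀ {N} → Monomial N → Monomial N → Monomial N
_⊕_ = zipWith ℕ._+_

_≟ₘ_ : ∀ {N} → DecidableEquality (Monomial N)
_≟ₘ_ = Vecₚ.≡-dec ℕ._≟_

⊕-assoc : ∀ {N} (α β γ : Monomial N) → (α ⊕ β) ⊕ γ ≡ α ⊕ (β ⊕ γ)
⊕-assoc = Vecₚ.zipWith-assoc ℕₚ.+-assoc

⊕-comm : ∀ {N} (α β : Monomial N) → α ⊕ β ≡ β ⊕ α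
⊕-comm = Vecₚ.zipWith-comm ℕₚ.+-comm

module Evaluation {c ℓ} (K : Field c ℓ) (N : ℕ) where
  open Field K hiding (zero)
  open Polynomials K N
  open Algebra.Properties.Ring ring using (-‿distribˡ-*; -‿+-comm; -0#≈0#)
  open Algebra.Properties.CommutativeSemigroup +-commutativeSemigroup using (interchange; x∙yz≈y∙xz)
  open Relation.Binary.Reasoning.Setoid setoid

  -- The linear extension of `F` to polynomials. Unlike `coeff` it never compares monomials, so its
  -- behaviour under sums and products follows by induction on the terms.
  ev : (Monomial N → Carrier) → Poly → Carrier
  ev F []            = 0#
  ev F ((a , β) ∷ p) = a * F β + ev F p

  indicator : ∀ {p} {P : Set p} → Dec P → Carrier
  indicator P? = if does P? then 1# else 0#

  coeff≈ev : ∀ p α → coeff p α ≈ ev (λ β → indicator (β ≟ₘ α)) p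
  coeff≈ev []            α = refl
  coeff≈ev ((a , β) ∷ p) α with β ≟ₘ α
  ... | yes _ = +-cong (sym (*-identityʳ a)) (coeff≈ev p α)
  ... | no  _ = trans (coeff≈ev p α) (sym (trans (+-congʳ (zeroʳ a)) (+-identityˡ _)))

  ev-cong : ∀ {F H} → (∀ β → F β ≈ H β) → ∀ p → ev F p ≈ ev H p
  ev-cong F≈H []            = refl
  ev-cong F≈H ((a , β) ∷ p) = +-cong (*-congˡ (F≈H β)) (ev-cong F≈H p)

  ev-++ : ∀ F p q → ev F (p ++ q) ≈ ev F p + ev F q
  ev-++ F []            q = sym (+-identityˡ _)
  ev-++ F ((a , β) ∷ p) q = trans (+-congˡ (ev-++ F p q)) (sym (+-assoc _ _ _))

  ev-neg : ∀ F p → ev F (-ₚ p) ≈ - ev F p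
  ev-neg F []            = sym -0#≈0#
  ev-neg F ((a , β) ∷ p) = trans (+-cong (sym (-‿distribˡ-* a (F β))) (ev-neg F p)) (-‿+-comm _ _)

  ev-* : ∀ F h g → ev F (h *ₚ g) ≈ ev (λ γ → ev (λ β → F (γ ⊕ β)) g) h
  ev-* F []            g = refl
  ev-* F ((a , γ) ∷ h) g = trans (ev-++ F (List.map _ g) (h *ₚ g)) (+-cong (shift g) (ev-* F h g))
    where
    shift : ∀ g → ev F (List.map (λ t → (a * proj₁ t , γ ⊕ proj₂ t)) g) ≈ a * ev (λ β → F (γ ⊕ β)) g
    shift []            = sym (zeroʳ a)
    shift ((x , β) ∷ g) = trans (+-cong (*-assoc a x _) (shift g)) (sym (distribˡ a _ _))

  without : Monomial N → Poly → Poly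
  without β [] = []
  without β ((a , γ) ∷ f) with γ ≟ₘ β
  ... | yes _ = without β f
  ... | no  _ = (a , γ) ∷ without β f

  length-without : ∀ β f → length (without β f) ℕ.≤ length f
  length-without β [] = z≤n
  length-without β ((a , γ) ∷ f) with γ ≟ₘ β
  ... | yes _ = ℕₚ.m≤n⇒m≤1+n (length-without β f)
  ... | no  _ = s≤s (length-without β f)

  ev-without : ∀ F β f → ev F f ≈ coeff f β * F β + ev F (without β f)
  ev-without F β [] = sym (trans (+-identityʳ _) (zeroˡ _))
  ev-without F β ((a , γ) ∷ f) with γ ≟ₘ β
  ... | yes ≡.refl = begin
    a * F β + ev F f                                       ≈⟨ +-congˡ (ev-without F β f) ⟩
    a * F β + (coeff f β * F β + ev F (without β f))       ≈⟨ +-assoc _ _ _ ⟨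
    a * F β + coeff f β * F β + ev F (without β f)         ≈⟨ +-congʳ (distribʳ (F β) a _) ⟨
    (a + coeff f β) * F β + ev F (without β f)             ∎
  ... | no _ = trans (+-congˡ (ev-without F β f)) (x∙yz≈y∙xz _ _ _)

  coeff-without : ∀ {β γ} → γ ≢ β → ∀ f → coeff (without β f) γ ≈ coeff f γ
  coeff-without γ≢β [] = refl
  coeff-without {β} {γ} γ≢β ((a , α) ∷ f) with α ≟ₘ β
  ... | yes ≡.refl with α ≟ₘ γ
  ...   | yes ≡.refl = contradiction ≡.refl γ≢β
  ...   | no _       = coeff-without γ≢β f
  coeff-without {β} {γ} γ≢β ((a , α) ∷ f) | no _ with α ≟ₘ γ
  ...   | yes _ = +-congˡ (coeff-without γ≢β f)
  ...   | no _  = coeff-without γ≢β f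

  All-without : ∀ {q} {Q : Carrier × Monomial N → Set q} β {f} → All Q f →
    All (λ t → Q t × proj₂ t ≢ β) (without β f)
  All-without β [] = []
  All-without β {(a , γ) ∷ f} (q ∷ qs) with γ ≟ₘ β
  ... | yes _  = All-without β qs
  ... | no γ≢β = (q , γ≢β) ∷ All-without β qs

  -- A list may repeat a monomial, so all terms with the first monomial are collected and removed
  -- together, and the induction runs on the length. Asking only for a vanishing product lets each
  -- monomial vanish either through its coefficient or through `F`.
  ev-vanishes : ∀ F f → All (λ t → coeff f (proj₂ t) * F (proj₂ t) ≈ 0#) f → ev F f ≈ 0#
  ev-vanishes F f = go f (<-wellFounded (length f))
    where
    go : ∀ f → Acc ℕ._<_ (length f) → All (λ t → coeff f (proj₂ t) * F (proj₂ t) ≈ 0#) f → ev F f ≈ 0#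
    go [] _ _ = refl
    go f@((a , β) ∷ f′) (acc rs) (p ∷ ps) = begin
      ev F f                                  ≈⟨ ev-without F β f ⟩
      coeff f β * F β + ev F (without β f)    ≈⟨ +-cong p (go (without β f) (rs shorter)
          (All.map (λ { (q , γ≢β) → trans (*-congʳ (coeff-without γ≢β f)) q }) (All-without β (p ∷ ps)))) ⟩
      0# + 0#                                 ≈⟨ +-identityˡ 0# ⟩
      0#                                      ∎
      where
      shorter : length (without β f) ℕ.< length f
      shorter with β ≟ₘ β
      ... | yes _ = s≤s (length-without β f′)
      ... | no β≢β = contradiction ≡.refl β≢β

  coeff-++ : ∀ p q α → coeff (p ++ q) α ≈ coeff p α + coeff q α
  coeff-++ p q α = trans (coeff≈ev (p ++ q) α)
    (trans (ev-++ _ p q) (sym (+-cong (coeff≈ev p α) (coeff≈ev q α))))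

  coeff-neg : ∀ p α → coeff (-ₚ p) α ≈ - coeff p α
  coeff-neg p α = trans (coeff≈ev (-ₚ p) α) (trans (ev-neg _ p) (-‿cong (sym (coeff≈ev p α))))

  -- The difference of `f` and `g` has only zero coefficients, so `ev-vanishes` applies to it.
  ev-resp : ∀ F f g → f ≈ₚ g → ev F f ≈ ev F g
  ev-resp F f g f≈g = begin
    ev F f                          ≈⟨ +-identityʳ _ ⟨
    ev F f + 0#                     ≈⟨ +-congˡ (-‿inverseˡ _) ⟨
    ev F f + (- ev F g + ev F g)    ≈⟨ +-assoc _ _ _ ⟨
    ev F f + - ev F g + ev F g      ≈⟨ +-congʳ difference ⟩
    0# + ev F g                     ≈⟨ +-identityˡ _ ⟩
    ev F g                          ∎
    where
    vanishes : ∀ α → coeff (f ++ (-ₚ g)) α ≈ 0#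
    vanishes α = begin
      coeff (f ++ (-ₚ g)) α       ≈⟨ coeff-++ f (-ₚ g) α ⟩
      coeff f α + coeff (-ₚ g) α  ≈⟨ +-cong (f≈g α) (coeff-neg g α) ⟩
      coeff g α + - coeff g α     ≈⟨ -‿inverseʳ _ ⟩
      0#                          ∎
    difference : ev F f + - ev F g ≈ 0#
    difference = begin
      ev F f + - ev F g       ≈⟨ +-congˡ (ev-neg F g) ⟨
      ev F f + ev F (-ₚ g)    ≈⟨ ev-++ F f (-ₚ g) ⟨
      ev F (f ++ (-ₚ g))      ≈⟨ ev-vanishes F (f ++ (-ₚ g)) (All.universal (λ t → trans (*-congʳ (vanishes (proj₂ t))) (zeroˡ _)) _) ⟩
      0#                      ∎

  -- Each coefficient is itself the functional of an indicator. Together with `ev-resp` this lets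
  -- identities of polynomials be checked on functionals.
  ev⇒≈ₚ : ∀ f g → (∀ F → ev F f ≈ ev F g) → f ≈ₚ g
  ev⇒≈ₚ f g eq α = trans (coeff≈ev f α) (trans (eq _) (sym (coeff≈ev g α)))

  ev-binom : ∀ F u v → ev F (binom u v) ≈ F u + - F v
  ev-binom F u v = +-cong (*-identityˡ _) (begin
    - 1# * F v + 0#  ≈⟨ +-identityʳ _ ⟩
    - 1# * F v       ≈⟨ -‿distribˡ-* 1# (F v) ⟨
    - (1# * F v)     ≈⟨ -‿cong (*-identityˡ _) ⟩
    - F v            ∎)

  ev-mono-* : ∀ F γ g → ev F (mono γ *ₚ g) ≈ ev (λ β → F (γ ⊕ β)) g
  ev-mono-* F γ g = trans (ev-* F (mono γ) g) (trans (+-identityʳ _) (*-identityˡ _))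

  mono-*-binom : ∀ γ u v → (mono γ *ₚ binom u v) ≈ₚ binom (γ ⊕ u) (γ ⊕ v)
  mono-*-binom γ u v = ev⇒≈ₚ (mono γ *ₚ binom u v) (binom (γ ⊕ u) (γ ⊕ v)) λ F →
    trans (ev-mono-* F γ (binom u v)) (trans (ev-binom _ u v) (sym (ev-binom F (γ ⊕ u) (γ ⊕ v))))

  ev-combo-++ : ∀ F l l′ → ev F (combo (l ++ l′)) ≈ ev F (combo l) + ev F (combo l′)
  ev-combo-++ F []            l′ = sym (+-identityˡ _)
  ev-combo-++ F ((h , g) ∷ l) l′ = begin
    ev F ((h *ₚ g) ++ combo (l ++ l′))                ≈⟨ ev-++ F (h *ₚ g) _ ⟩
    ev F (h *ₚ g) + ev F (combo (l ++ l′))            ≈⟨ +-congˡ (ev-combo-++ F l l′) ⟩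
    ev F (h *ₚ g) + (ev F (combo l) + ev F (combo l′)) ≈⟨ +-assoc _ _ _ ⟨
    ev F (h *ₚ g) + ev F (combo l) + ev F (combo l′)  ≈⟨ +-congʳ (ev-++ F (h *ₚ g) (combo l)) ⟨
    ev F ((h *ₚ g) ++ combo l) + ev F (combo l′)      ∎

  ev-+ : ∀ F H p → ev (λ β → F β + H β) p ≈ ev F p + ev H p
  ev-+ F H []            = sym (+-identityˡ _)
  ev-+ F H ((a , β) ∷ p) = trans (+-cong (distribˡ a _ _) (ev-+ F H p)) (interchange _ _ _ _)

  ev-0 : ∀ p → ev (λ _ → 0#) p ≈ 0#
  ev-0 []            = refl
  ev-0 ((a , β) ∷ p) = trans (+-cong (zeroʳ a) (ev-0 p)) (+-identityˡ 0#)

  module _ {s} {S : Poly → Set s} where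

    InIdeal-resp : ∀ f g → f ≈ₚ g → InIdeal S f → InIdeal S g
    InIdeal-resp f g f≈g (l , all , f≈) = l , all , λ α → trans (sym (f≈g α)) (f≈ α)

    InIdeal-∋ : ∀ γ {g} → S g → InIdeal S (mono γ *ₚ g)
    InIdeal-∋ γ {g} Sg = (mono γ , g) ∷ [] , Sg ∷ [] , ev⇒≈ₚ (mono γ *ₚ g) (combo ((mono γ , g) ∷ []))
      λ F → sym (trans (ev-++ F (mono γ *ₚ g) []) (+-identityʳ _))

    InIdeal-0 : InIdeal S 0ₚ
    InIdeal-0 = [] , [] , λ α → refl

    InIdeal-+ : ∀ {f g} → InIdeal S f → InIdeal S g → InIdeal S (f +ₚ g)
    InIdeal-+ {f} {g} (l , all , f≈) (l′ , all′ , g≈) =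
      l ++ l′ , Allₚ.++⁺ all all′ , ev⇒≈ₚ (f +ₚ g) (combo (l ++ l′)) λ F → begin
        ev F (f ++ g)                      ≈⟨ ev-++ F f g ⟩
        ev F f + ev F g                    ≈⟨ +-cong (ev-resp F f (combo l) f≈) (ev-resp F g (combo l′) g≈) ⟩
        ev F (combo l) + ev F (combo l′)   ≈⟨ ev-combo-++ F l l′ ⟨
        ev F (combo (l ++ l′))             ∎

    InIdeal-* : ∀ h {f} → InIdeal S f → InIdeal S (h *ₚ f)
    InIdeal-* h {f} (l , all , f≈) = List.map times l , Allₚ.map⁺ (All.map id all) ,
      ev⇒≈ₚ (h *ₚ f) (combo (List.map times l)) λ F → begin
        ev F (h *ₚ f)                                          ≈⟨ ev-* F h f ⟩
        ev (λ γ → ev (λ β → F (γ ⊕ β)) f) h                    ≈⟨ ev-cong (λ γ → ev-resp _ f (combo l) f≈) h ⟩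
        ev (λ γ → ev (λ β → F (γ ⊕ β)) (combo l)) h            ≈⟨ distribute F l ⟩
        ev F (combo (List.map times l))                        ∎
      where
      times : Poly × Poly → Poly × Poly
      times (h′ , g) = h *ₚ h′ , g
      distribute : ∀ F l → ev (λ γ → ev (λ β → F (γ ⊕ β)) (combo l)) h ≈ ev F (combo (List.map times l))
      distribute F [] = ev-0 h
      distribute F ((h′ , g) ∷ l) = begin
        ev (λ γ → ev (λ β → F (γ ⊕ β)) ((h′ *ₚ g) ++ combo l)) h
          ≈⟨ ev-cong (λ γ → trans (ev-++ _ (h′ *ₚ g) (combo l)) (+-congʳ (ev-* _ h′ g))) h ⟩
        ev (λ γ → ev (λ γ′ → ev (λ β → F (γ ⊕ (γ′ ⊕ β))) g) h′ + ev (λ β → F (γ ⊕ β)) (combo l)) h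
          ≈⟨ ev-+ _ _ h ⟩
        ev (λ γ → ev (λ γ′ → ev (λ β → F (γ ⊕ (γ′ ⊕ β))) g) h′) h + ev (λ γ → ev (λ β → F (γ ⊕ β)) (combo l)) h
          ≈⟨ +-cong (ev-cong (λ γ → ev-cong (λ γ′ → ev-cong (λ β → reflexive (≡.cong F (≡.sym (⊕-assoc γ γ′ β)))) g) h′) h) (distribute F l) ⟩
        ev (λ γ → ev (λ γ′ → ev (λ β → F ((γ ⊕ γ′) ⊕ β)) g) h′) h + ev F (combo (List.map times l))
          ≈⟨ +-congʳ (trans (ev-* F (h *ₚ h′) g) (ev-* _ h h′)) ⟨
        ev F ((h *ₚ h′) *ₚ g) + ev F (combo (List.map times l))
          ≈⟨ ev-++ F ((h *ₚ h′) *ₚ g) _ ⟨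
        ev F (((h *ₚ h′) *ₚ g) ++ combo (List.map times l)) ∎

  InIdeal-⊆ : ∀ {s t} {S : Poly → Set s} {T : Poly → Set t} →
    (∀ {g} → S g → InIdeal T g) → ∀ {f} → InIdeal S f → InIdeal T f
  InIdeal-⊆ {S = S} {T} S⊆T {f} (l , all , f≈) = InIdeal-resp (combo l) f (λ α → sym (f≈ α)) (go l all)
    where
    go : ∀ l → All (S ∘ proj₂) l → InIdeal T (combo l)
    go []            []         = InIdeal-0
    go ((h , g) ∷ l) (Sg ∷ Sgs) = InIdeal-+ {f = h *ₚ g} (InIdeal-* h (S⊆T Sg)) (go l Sgs)

  coeff-binom : ∀ u v α → coeff (binom u v) α ≈ indicator (u ≟ₘ α) + - indicator (v ≟ₘ α)
  coeff-binom u v α = trans (coeff≈ev (binom u v) α) (ev-binom _ u v)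

-- Fibers of an integer matrix

∑-cong : ∀ {N} {f g : Fin N → ℤ} → (∀ i → f i ≡ g i) → ∑ f ≡ ∑ g
∑-cong {zero}  eq = ≡.refl
∑-cong {suc N} eq = ≡.cong₂ ℤ._+_ (eq zero) (∑-cong (eq ∘ suc))

∑-+ : ∀ {N} (f g : Fin N → ℤ) → ∑ (λ i → f i ℤ.+ g i) ≡ ∑ f ℤ.+ ∑ g
∑-+ {zero}  f g = ≡.refl
∑-+ {suc N} f g = ≡.trans (≡.cong (ℤ._+_ (f zero ℤ.+ g zero)) (∑-+ (f ∘ suc) (g ∘ suc)))
  (interchange (f zero) (g zero) _ _)
  where open Algebra.Properties.CommutativeSemigroup ℤₚ.+-commutativeSemigroup using (interchange)

≗⇒≡ : ∀ {N} {u v : Monomial N} → (∀ i → lookup u i ≡ lookup v i) → u ≡ v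
≗⇒≡ {u = u} {v} eq = ≡.trans (≡.sym (Vecₚ.tabulate∘lookup u)) (≡.trans (Vecₚ.tabulate-cong eq) (Vecₚ.tabulate∘lookup v))

lookup-⊕ : ∀ {N} (u v : Monomial N) i → lookup (u ⊕ v) i ≡ lookup u i ℕ.+ lookup v i
lookup-⊕ u v i = Vecₚ.lookup-zipWith ℕ._+_ i u v

∣ₘ⇒⊕ : ∀ {N} {p u : Monomial N} → p ∣ₘ u → ∃ λ γ → u ≡ γ ⊕ p
∣ₘ⇒⊕ {p = p} {u} p∣u = zipWith ℕ._∸_ u p , ≗⇒≡ λ i → ≡.sym (begin
  lookup (zipWith ℕ._∸_ u p ⊕ p) i              ≡⟨ lookup-⊕ (zipWith ℕ._∸_ u p) p i ⟩
  lookup (zipWith ℕ._∸_ u p) i ℕ.+ lookup p i   ≡⟨ ≡.cong (ℕ._+ lookup p i) (Vecₚ.lookup-zipWith ℕ._∸_ i u p) ⟩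
  lookup u i ℕ.∸ lookup p i ℕ.+ lookup p i      ≡⟨ ℕₚ.m∸n+n≡m (p∣u i) ⟩
  lookup u i                                    ∎)
  where open ≡.≡-Reasoning

pos-⊖ : ∀ m n → posPart (m ℤ.⊖ n) ≡ m ℕ.∸ n
pos-⊖ m       zero    = ≡.refl
pos-⊖ zero    (suc n) = ≡.refl
pos-⊖ (suc m) (suc n) = ≡.trans (≡.cong posPart (ℤₚ.[1+m]⊖[1+n]≡m⊖n m n)) (pos-⊖ m n)

neg-⊖ : ∀ m n → negPart (m ℤ.⊖ n) ≡ n ℕ.∸ m
neg-⊖ m       zero    = ≡.sym (ℕₚ.0∸n≡0 m)
neg-⊖ zero    (suc n) = ≡.refl
neg-⊖ (suc m) (suc n) = ≡.trans (≡.cong negPart (ℤₚ.[1+m]⊖[1+n]≡m⊖n m n)) (neg-⊖ m n)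

pos-neg : ∀ b → b ℤ.+ +ℤ negPart b ≡ +ℤ posPart b
pos-neg (+ℤ k)    = ℤₚ.+-identityʳ (+ℤ k)
pos-neg -[1+ k ] = ℤₚ.+-inverseˡ (+ℤ suc k)

⊖-+ : ∀ m n → m ℤ.⊖ n ℤ.+ +ℤ n ≡ +ℤ m
⊖-+ m n = ≡.trans (≡.cong (ℤ._+ +ℤ n) (≡.sym (ℤₚ.m-n≡m⊖n m n)))
  (≡.trans (ℤₚ.+-assoc (+ℤ m) (ℤ.- +ℤ n) (+ℤ n)) (≡.trans (≡.cong (ℤ._+_ (+ℤ m)) (ℤₚ.+-inverseˡ (+ℤ n))) (ℤₚ.+-identityʳ (+ℤ m))))

m⊓n+[m∸n] : ∀ m n → m ℕ.⊓ n ℕ.+ (m ℕ.∸ n) ≡ m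
m⊓n+[m∸n] m n = ≡.trans (ℕₚ.+-comm (m ℕ.⊓ n) _) (≡.trans (≡.cong (m ℕ.∸ n ℕ.+_) (ℕₚ.⊓-comm m n)) (lem m n))
  where
  lem : ∀ m n → m ℕ.∸ n ℕ.+ n ℕ.⊓ m ≡ m
  lem m       zero    = ℕₚ.+-identityʳ m
  lem zero    (suc n) = ≡.refl
  lem (suc m) (suc n) = ≡.trans (ℕₚ.+-suc (m ℕ.∸ n) _) (≡.cong suc (lem m n))

_⁺ _⁻ : ∀ {N} → (Fin N → ℤ) → Monomial N
b ⁺ = Vec.tabulate (posPart ∘ b)
b ⁻ = Vec.tabulate (negPart ∘ b)

module Fibers {n N : ℕ} (A : Matrix n N) where

  image : Monomial N → Fin n → ℤ
  image u r = ∑ (λ c → A c r ℤ.* +ℤ lookup u c)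

  SameFiber : Monomial N → Monomial N → Set
  SameFiber u v = ∀ r → image u r ≡ image v r

  sameFiber? : ∀ u v → Dec (SameFiber u v)
  sameFiber? u v = Finₚ.all? (λ r → image u r ℤ.≟ image v r)

  image-⊕ : ∀ u v r → image (u ⊕ v) r ≡ image u r ℤ.+ image v r
  image-⊕ u v r = ≡.trans (∑-cong λ c → ≡.trans (≡.cong (λ x → A c r ℤ.* +ℤ x) (lookup-⊕ u v c))
      (ℤₚ.*-distribˡ-+ (A c r) (+ℤ lookup u c) (+ℤ lookup v c)))
    (∑-+ (λ c → A c r ℤ.* +ℤ lookup u c) _)

  sameFiber-sym : ∀ {u v} → SameFiber u v → SameFiber v u
  sameFiber-sym u~v r = ≡.sym (u~v r)

  sameFiber-trans : ∀ {u v w} → SameFiber u v → SameFiber v w → SameFiber u w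
  sameFiber-trans u~v v~w r = ≡.trans (u~v r) (v~w r)

  sameFiber-⊕ : ∀ γ {u v} → SameFiber u v → SameFiber (γ ⊕ u) (γ ⊕ v)
  sameFiber-⊕ γ {u} {v} u~v r = ≡.trans (image-⊕ γ u r)
    (≡.trans (≡.cong (ℤ._+_ (image γ r)) (u~v r)) (≡.sym (image-⊕ γ v r)))

  -- The general form serves both passages between kernel vectors and fibers: in one, `p` and `q`
  -- are the two parts of `b`; in the other, `b` is the difference of two given monomials.
  image-difference : ∀ (b : Fin N → ℤ) p q → (∀ c → b c ℤ.+ +ℤ lookup q c ≡ +ℤ lookup p c) →
    ∀ r → ∑ (λ c → A c r ℤ.* b c) ℤ.+ image q r ≡ image p r
  image-difference b p q eq r = ≡.trans (≡.sym (∑-+ (λ c → A c r ℤ.* b c) _))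
    (∑-cong λ c → ≡.trans (≡.sym (ℤₚ.*-distribˡ-+ (A c r) (b c) _)) (≡.cong (A c r ℤ.*_) (eq c)))

  kernel⇒sameFiber : ∀ b → InKernel A b → SameFiber (b ⁺) (b ⁻)
  kernel⇒sameFiber b Ab≡0 r = ≡.trans (≡.sym (image-difference b (b ⁺) (b ⁻) eq r))
    (≡.trans (≡.cong (ℤ._+ image (b ⁻) r) (Ab≡0 r)) (ℤₚ.+-identityˡ _))
    where
    eq : ∀ c → b c ℤ.+ +ℤ lookup (b ⁻) c ≡ +ℤ lookup (b ⁺) c
    eq c = ≡.trans (≡.cong (λ x → b c ℤ.+ +ℤ x) (Vecₚ.lookup∘tabulate (negPart ∘ b) c))
      (≡.trans (pos-neg (b c)) (≡.cong +ℤ_ (≡.sym (Vecₚ.lookup∘tabulate (posPart ∘ b) c))))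

  sameFiber⇒kernel : ∀ u v → SameFiber u v → InKernel A (λ c → lookup u c ℤ.⊖ lookup v c)
  sameFiber⇒kernel u v u~v r = ≡.trans (cancel _ (image v r)) (≡.trans
    (≡.cong (ℤ._- image v r) (image-difference (λ c → lookup u c ℤ.⊖ lookup v c) u v (λ c → ⊖-+ (lookup u c) (lookup v c)) r))
    (≡.trans (≡.cong (ℤ._- image v r) (u~v r)) (ℤₚ.+-inverseʳ (image v r))))
    where
    cancel : ∀ x y → x ≡ x ℤ.+ y ℤ.- y
    cancel x y = ≡.sym (≡.trans (ℤₚ.+-assoc x y _) (≡.trans (≡.cong (ℤ._+_ x) (ℤₚ.+-inverseʳ y)) (ℤₚ.+-identityʳ x)))

  Move : Monomial N → Monomial N → Set
  Move u v = ∃ λ p → ∃ λ q → ∃ λ γ →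
    deg p ≡ 2 × deg q ≡ 2 × SameFiber p q × u ≡ γ ⊕ p × v ≡ γ ⊕ q

  move-sym : ∀ {u v} → Move u v → Move v u
  move-sym (p , q , γ , dp , dq , p~q , eu , ev) = q , p , γ , dq , dp , sameFiber-sym {p} {q} p~q , ev , eu

  Connected : Monomial N → Monomial N → Set
  Connected = Star Move

  connected-sym : ∀ {u v} → Connected u v → Connected v u
  connected-sym = reverse move-sym

  FibersConnected : Set
  FibersConnected = ∀ u v → SameFiber u v → Connected u v

  -- Union-find on finitely many links: the class of `α` is redirected to the representative of `β`.
  -- Only equality of monomials is decided on the way, never `Connected`.
  representatives : ∀ ps → All (uncurry Connected) ps → ∃ λ (rep : Monomial N → Monomial N) →
    (∀ x → Connected x (rep x)) × All (λ p → rep (proj₁ p) ≡ rep (proj₂ p)) ps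
  representatives [] [] = id , (λ x → ε) , []
  representatives ((α , β) ∷ ps) (α~β ∷ conn) with rep , x~rep , eqs ← representatives ps conn =
    merge ∘ rep , (λ x → x~rep x ◅◅ merge-connected (rep x)) , merged ∷ All.map (≡.cong merge) eqs
    where
    merge : Monomial N → Monomial N
    merge x with x ≟ₘ rep α
    ... | yes _ = rep β
    ... | no _  = x
    merge-connected : ∀ x → Connected x (merge x)
    merge-connected x with x ≟ₘ rep α
    ... | yes ≡.refl = connected-sym (x~rep α) ◅◅ α~β ◅◅ x~rep β
    ... | no _       = ε
    merged : merge (rep α) ≡ merge (rep β)
    merged with rep α ≟ₘ rep α | rep β ≟ₘ rep α
    ... | yes _ | yes _ = ≡.refl
    ... | yes _ | no _  = ≡.refl
    ... | no ¬r | _     = contradiction ≡.refl ¬r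

-- Toric ideals and connectivity of fibers

module ToricConnectivity {c ℓ} (K : Field c ℓ) {n N : ℕ} (A : Matrix n N) where
  open Field K hiding (zero)
  open Toric K A
  open Fibers A
  open Evaluation K N
  open Algebra.Properties.Ring ring using (-‿+-comm; -0#≈0#; -‿involutive)
  open Relation.Binary.Reasoning.Setoid setoid

  indicator-cong : ∀ {p q} {P : Set p} {Q : Set q} (P? : Dec P) (Q? : Dec Q) →
    (P → Q) → (Q → P) → indicator P? ≈ indicator Q?
  indicator-cong (yes p) (yes q) _ _ = refl
  indicator-cong (yes p) (no ¬q) f _ = contradiction (f p) ¬q
  indicator-cong (no ¬p) (yes q) _ g = contradiction (g q) ¬p
  indicator-cong (no ¬p) (no ¬q) _ _ = refl

  indicator-yes : ∀ {p} {P : Set p} (P? : Dec P) → P → indicator P? ≈ 1#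
  indicator-yes (yes _) _ = refl
  indicator-yes (no ¬p) p = contradiction p ¬p

  indicator-no : ∀ {p} {P : Set p} (P? : Dec P) → ¬ P → indicator P? ≈ 0#
  indicator-no (yes p) ¬p = contradiction p ¬p
  indicator-no (no _)  _  = refl

  x≈y⇒x-y≈0 : ∀ {x y} → x ≈ y → x + - y ≈ 0#
  x≈y⇒x-y≈0 x≈y = trans (+-congʳ x≈y) (-‿inverseʳ _)

  1-0≉0 : ∀ {x y} → x ≈ 1# → y ≈ 0# → ¬ (x + - y ≈ 0#)
  1-0≉0 {x} {y} x≈1 y≈0 x-y≈0 = 0≉1 (begin
    0#       ≈⟨ x-y≈0 ⟨
    x + - y  ≈⟨ +-cong x≈1 (trans (-‿cong y≈0) -0#≈0#) ⟩
    1# + 0#  ≈⟨ +-identityʳ 1# ⟩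
    1#       ∎)

  -- A monomial multiple of a kernel binomial is a difference of two monomials of one fiber, on
  -- which `F` takes the same value.
  ev-toric : ∀ F → (∀ u v → SameFiber u v → F u ≈ F v) → ∀ f → ToricIdeal f → ev F f ≈ 0#
  ev-toric F F-resp f (l , gens , f≈) = trans (ev-resp F f (combo l) f≈) (go l gens)
    where
    go : ∀ l → All (ToricGenerator ∘ proj₂) l → ev F (combo l) ≈ 0#
    go [] [] = refl
    go ((h , g) ∷ l) ((b , Ab≡0 , g≈) ∷ gens) = begin
      ev F ((h *ₚ g) ++ combo l)                             ≈⟨ ev-++ F (h *ₚ g) (combo l) ⟩
      ev F (h *ₚ g) + ev F (combo l)                         ≈⟨ +-cong (ev-* F h g) (go l gens) ⟩
      ev (λ γ → ev (λ β → F (γ ⊕ β)) g) h + 0#               ≈⟨ +-identityʳ _ ⟩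
      ev (λ γ → ev (λ β → F (γ ⊕ β)) g) h                    ≈⟨ ev-cong (λ γ → trans (ev-resp _ g (kernelBinomial b) g≈)
          (trans (ev-binom (λ β → F (γ ⊕ β)) (b ⁺) (b ⁻)) (x≈y⇒x-y≈0 (F-resp (γ ⊕ (b ⁺)) (γ ⊕ (b ⁻)) (sameFiber-⊕ γ {b ⁺} {b ⁻} (kernel⇒sameFiber b Ab≡0)))))) h ⟩
      ev (λ _ → 0#) h                                        ≈⟨ ev-0 h ⟩
      0#                                                     ∎

  fiberIndicator-resp : ∀ α u v → SameFiber u v → indicator (sameFiber? α u) ≈ indicator (sameFiber? α v)
  fiberIndicator-resp α u v u~v = indicator-cong (sameFiber? α u) (sameFiber? α v)
    (λ α~u → sameFiber-trans {α} {u} {v} α~u u~v)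
    (λ α~v → sameFiber-trans {α} {v} {u} α~v (sameFiber-sym {u} {v} u~v))

  -- The indicator of the fiber of `p` is constant on fibers and hence kills the toric ideal; on
  -- `binom p q` it would take the value one if `q` lay outside that fiber.
  toricBinomial⇒sameFiber : ∀ {g} p q → g ≈ₚ binom p q → ToricIdeal g → SameFiber p q
  toricBinomial⇒sameFiber {g} p q g≈ g∈I with sameFiber? p q
  ... | yes p~q = p~q
  ... | no ¬p~q = contradiction (begin
      F p + - F q         ≈⟨ ev-binom F p q ⟨
      ev F (binom p q)    ≈⟨ ev-resp F g (binom p q) g≈ ⟨
      ev F g              ≈⟨ ev-toric F (fiberIndicator-resp p) g g∈I ⟩
      0#                  ∎)
      (1-0≉0 (indicator-yes (sameFiber? p p) (λ r → ≡.refl)) (indicator-no (sameFiber? p q) ¬p~q))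
    where
    F : Monomial N → Carrier
    F β = indicator (sameFiber? p β)

  -- Once the greatest common divisor `γ` of `u` and `v` is divided out, the positive and negative
  -- parts of the exponent difference remain, so the binomial is `γ` times a kernel binomial.
  sameFiber⇒toricBinomial : ∀ u v → SameFiber u v → ToricIdeal (binom u v)
  sameFiber⇒toricBinomial u v u~v = InIdeal-resp (mono γ *ₚ kernelBinomial b) (binom u v)
    (λ α → trans (mono-*-binom γ _ _ α) (reflexive (≡.cong₂ (λ x y → coeff (binom x y) α) pos≡ neg≡)))
    (InIdeal-∋ γ {kernelBinomial b} (b , sameFiber⇒kernel u v u~v , λ α → refl))
    where
    b : Fin N → ℤ
    b c = lookup u c ℤ.⊖ lookup v c
    γ : Monomial N
    γ = zipWith ℕ._⊓_ u v
    lookup-γ : ∀ (f : Fin N → ℕ) i → lookup (γ ⊕ Vec.tabulate f) i ≡ lookup u i ℕ.⊓ lookup v i ℕ.+ f i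
    lookup-γ f i = ≡.trans (lookup-⊕ γ _ i) (≡.cong₂ ℕ._+_ (Vecₚ.lookup-zipWith ℕ._⊓_ i u v) (Vecₚ.lookup∘tabulate f i))
    pos≡ : γ ⊕ (b ⁺) ≡ u
    pos≡ = ≗⇒≡ λ i → ≡.trans (lookup-γ (posPart ∘ b) i)
      (≡.trans (≡.cong (lookup u i ℕ.⊓ lookup v i ℕ.+_) (pos-⊖ (lookup u i) (lookup v i)))
               (m⊓n+[m∸n] (lookup u i) (lookup v i)))
    neg≡ : γ ⊕ (b ⁻) ≡ v
    neg≡ = ≗⇒≡ λ i → ≡.trans (lookup-γ (negPart ∘ b) i)
      (≡.trans (≡.cong₂ ℕ._+_ (ℕₚ.⊓-comm (lookup u i) (lookup v i)) (neg-⊖ (lookup u i) (lookup v i)))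
               (m⊓n+[m∸n] (lookup v i) (lookup u i)))

  QuadraticToric : Poly → Set (c ⊔ ℓ)
  QuadraticToric g = IsQuadraticBinomial g × ToricIdeal g

  -- Each term of a multiplier contributes one move. The vanishing is proved for every `F` that
  -- matches the ends of the moves, because the functional to be used is built only after the list
  -- of moves is known.
  movesOf : ∀ l → All (QuadraticToric ∘ proj₂) l → ∃ λ ps → All (uncurry Connected) ps ×
    (∀ F → All (λ p → F (proj₁ p) ≈ F (proj₂ p)) ps → ev F (combo l) ≈ 0#)
  movesOf [] [] = [] , [] , λ F _ → refl
  movesOf ((h , g) ∷ l) (((p , q , dp , dq , g≈) , g∈I) ∷ quads) with ps , conn , vanish ← movesOf l quads =
    List.map move h ++ ps , Allₚ.++⁺ (connected h) conn , λ F eqs → begin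
      ev F ((h *ₚ g) ++ combo l)                          ≈⟨ ev-++ F (h *ₚ g) (combo l) ⟩
      ev F (h *ₚ g) + ev F (combo l)                      ≈⟨ +-cong (ev-* F h g) (vanish F (Allₚ.++⁻ʳ (List.map move h) eqs)) ⟩
      ev (λ γ → ev (λ β → F (γ ⊕ β)) g) h + 0#            ≈⟨ +-identityʳ _ ⟩
      ev (λ γ → ev (λ β → F (γ ⊕ β)) g) h                 ≈⟨ ev-cong (λ γ → trans (ev-resp _ g (binom p q) g≈) (ev-binom _ p q)) h ⟩
      ev (λ γ → F (γ ⊕ p) + - F (γ ⊕ q)) h                ≈⟨ telescopes F h (Allₚ.++⁻ˡ (List.map move h) eqs) ⟩
      0#                                                  ∎
    where
    move : Carrier × Monomial N → Monomial N × Monomial N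
    move (_ , γ) = γ ⊕ p , γ ⊕ q
    connected : ∀ h → All (uncurry Connected) (List.map move h)
    connected [] = []
    connected ((_ , γ) ∷ h) =
      ((p , q , γ , dp , dq , toricBinomial⇒sameFiber {g} p q g≈ g∈I , ≡.refl , ≡.refl) ◅ ε) ∷ connected h
    telescopes : ∀ F h → All (λ p → F (proj₁ p) ≈ F (proj₂ p)) (List.map move h) →
      ev (λ γ → F (γ ⊕ p) + - F (γ ⊕ q)) h ≈ 0#
    telescopes F [] [] = refl
    telescopes F ((a , γ) ∷ h) (eq ∷ eqs) =
      trans (+-cong (trans (*-congˡ (x≈y⇒x-y≈0 eq)) (zeroʳ a)) (telescopes F h eqs)) (+-identityˡ 0#)

  -- Only finitely many moves occur in a representation of u − v, so the connected components
  -- they generate have computable representatives; summing coefficients over the component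
  -- of u shows that v lies in it.
  generated⇒connected : GeneratedByQuadraticBinomials → FibersConnected
  generated⇒connected gen u v u~v
    with l , quads , u-v≈ ← gen (binom u v) (sameFiber⇒toricBinomial u v u~v)
    with ps , conn , vanish ← movesOf l quads
    with rep , x~rep , eqs ← representatives ps conn
    with rep v ≟ₘ rep u
  ... | yes eq = x~rep u ◅◅ ≡.subst (λ x → Connected x v) eq (connected-sym (x~rep v))
  ... | no neq = contradiction (begin
      F u + - F v         ≈⟨ ev-binom F u v ⟨
      ev F (binom u v)    ≈⟨ ev-resp F (binom u v) (combo l) u-v≈ ⟩
      ev F (combo l)      ≈⟨ vanish F (All.map (λ e → reflexive (≡.cong (λ x → indicator (x ≟ₘ rep u)) e)) eqs) ⟩
      0#                  ∎)
      (1-0≉0 (indicator-yes (rep u ≟ₘ rep u) ≡.refl) (indicator-no (rep v ≟ₘ rep u) neq))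
    where
    F : Monomial N → Carrier
    F x = indicator (rep x ≟ₘ rep u)

  -- A path of moves turns a kernel binomial into a telescoping sum of monomial multiples of
  -- quadratic binomials.
  connected⇒generated : FibersConnected → GeneratedByQuadraticBinomials
  connected⇒generated conn f = InIdeal-⊆ {S = ToricGenerator} (λ {g} → generator {g}) {f}
    where
    chain : ∀ {u v} → Connected u v → InIdeal QuadraticToric (binom u v)
    chain {u} ε = InIdeal-resp [] (binom u u)
      (ev⇒≈ₚ [] (binom u u) λ F → sym (trans (ev-binom F u u) (-‿inverseʳ (F u)))) InIdeal-0
    chain {u} {v} (_◅_ {j = w} (p , q , γ , dp , dq , p~q , ≡.refl , ≡.refl) rest) =
      InIdeal-resp ((mono γ *ₚ binom p q) +ₚ binom w v) (binom u v)
        (ev⇒≈ₚ ((mono γ *ₚ binom p q) +ₚ binom w v) (binom u v) λ F → begin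
          ev F ((mono γ *ₚ binom p q) +ₚ binom w v)
            ≈⟨ ev-++ F (mono γ *ₚ binom p q) (binom w v) ⟩
          ev F (mono γ *ₚ binom p q) + ev F (binom w v)
            ≈⟨ +-cong (trans (ev-mono-* F γ (binom p q)) (ev-binom _ p q)) (ev-binom F w v) ⟩
          (F u + - F w) + (F w + - F v)
            ≈⟨ +-assoc _ _ _ ⟩
          F u + (- F w + (F w + - F v))
            ≈⟨ +-congˡ (trans (sym (+-assoc _ _ _)) (trans (+-congʳ (-‿inverseˡ (F w))) (+-identityˡ _))) ⟩
          F u + - F v
            ≈⟨ ev-binom F u v ⟨
          ev F (binom u v) ∎)
        (InIdeal-+ {f = mono γ *ₚ binom p q}
          (InIdeal-∋ γ {binom p q} ((p , q , dp , dq , λ _ → refl) , sameFiber⇒toricBinomial p q p~q)) (chain rest))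
    generator : ∀ {g} → ToricGenerator g → InIdeal QuadraticToric g
    generator {g} (b , Ab≡0 , g≈) = InIdeal-resp (kernelBinomial b) g (λ α → sym (g≈ α))
      (chain (conn (b ⁺) (b ⁻) (kernel⇒sameFiber b Ab≡0)))

  coeff-binom-first : ∀ {u v} → u ≢ v → ¬ (coeff (binom u v) u ≈ 0#)
  coeff-binom-first {u} {v} u≢v eq = 1-0≉0 (indicator-yes (u ≟ₘ u) ≡.refl) (indicator-no (v ≟ₘ u) (u≢v ∘ ≡.sym))
    (trans (sym (coeff-binom u v u)) eq)

  coeff-binom-second : ∀ {u v} → u ≢ v → ¬ (coeff (binom u v) v ≈ 0#)
  coeff-binom-second {u} {v} u≢v eq = coeff-binom-first (u≢v ∘ ≡.sym) (begin
    coeff (binom v u) v                                   ≈⟨ coeff-binom v u v ⟩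
    indicator (v ≟ₘ v) + - indicator (u ≟ₘ v)             ≈⟨ trans (+-congʳ (sym (-‿involutive _))) (trans (-‿+-comm _ _) (-‿cong (+-comm _ _))) ⟩
    - (indicator (u ≟ₘ v) + - indicator (v ≟ₘ v))         ≈⟨ -‿cong (coeff-binom u v v) ⟨
    - coeff (binom u v) v                                 ≈⟨ trans (-‿cong eq) -0#≈0# ⟩
    0#                                                    ∎)

  coeff-binom-other : ∀ {u v α} → u ≢ α → v ≢ α → coeff (binom u v) α ≈ 0#
  coeff-binom-other {u} {v} {α} u≢α v≢α = trans (coeff-binom u v α)
    (x≈y⇒x-y≈0 (trans (indicator-no (u ≟ₘ α) u≢α) (sym (indicator-no (v ≟ₘ α) v≢α))))

  coeff-binom-same : ∀ u α → coeff (binom u u) α ≈ 0#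
  coeff-binom-same u α = trans (coeff-binom u u α) (-‿inverseʳ _)

  coeff-binom≉0 : ∀ u v α → ¬ (coeff (binom u v) α ≈ 0#) → α ≡ u ⊎ α ≡ v
  coeff-binom≉0 u v α ≉0 = cases (u ≟ₘ α) (v ≟ₘ α)
    where
    cases : Dec (u ≡ α) → Dec (v ≡ α) → α ≡ u ⊎ α ≡ v
    cases (yes u≡α) _         = inj₁ (≡.sym u≡α)
    cases (no _)    (yes v≡α) = inj₂ (≡.sym v≡α)
    cases (no u≢α)  (no v≢α)  = contradiction (coeff-binom-other u≢α v≢α) ≉0

  module _ (O : MonomialOrder) where
    open MonomialOrder O
    open IsStrictTotalOrder isStrictTotalOrder using (compare; irrefl)

    initial-binom : ∀ {u v} → v ≺ u → IsInitial O (binom u v) u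
    initial-binom {u} {v} v≺u = coeff-binom-first (λ u≡v → irrefl (≡.sym u≡v) v≺u) ,
      λ β ≉0 → Sum.map₂ (λ { ≡.refl → v≺u }) (coeff-binom≉0 u v β ≉0)

    -- Either monomial of the binomial may be the initial one; the other is then the target of a
    -- move. If the two coincide, the polynomial is zero and has no initial monomial.
    initial-move : ∀ {g β} → IsQuadraticBinomial g → ToricIdeal g → IsInitial O g β →
      ∃ λ q → deg β ≡ 2 × deg q ≡ 2 × SameFiber β q × q ≺ β
    initial-move {g} {β} (p , q , dp , dq , g≈) g∈I (β≉0 , initial) with p ≟ₘ q
    ... | yes ≡.refl = contradiction (trans (g≈ β) (coeff-binom-same p β)) β≉0
    ... | no p≢q with coeff-binom≉0 p q β (λ ≈0 → β≉0 (trans (g≈ β) ≈0))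
    ...   | inj₁ ≡.refl = q , dp , dq , toricBinomial⇒sameFiber {g} p q g≈ g∈I ,
              fromInj₂ (λ q≡p → contradiction (≡.sym q≡p) p≢q)
                (initial q (λ ≈0 → coeff-binom-second p≢q (trans (sym (g≈ q)) ≈0)))
    ...   | inj₂ ≡.refl = p , dq , dp , sameFiber-sym {p} {q} (toricBinomial⇒sameFiber {g} p q g≈ g∈I) ,
              fromInj₂ (λ p≡q → contradiction p≡q p≢q)
                (initial p (λ ≈0 → coeff-binom-first p≢q (trans (sym (g≈ p)) ≈0)))

    -- The binomial of `u` and `v` has initial monomial `u`, so the initial monomial of a basis
    -- element divides `u` and gives a move downwards.
    reduce : ∀ {Gb} → All IsQuadraticBinomial Gb → IsGroebnerBasis O ToricIdeal Gb →
      ∀ {u} → Acc _≺_ u → ∀ {v} → v ≺ u → SameFiber u v → Connected u v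
    reduce quads gb@(Gb⊆I , divides) {u} (acc rs) {v} v≺u u~v
      with g , g∈Gb , β , β-initial , β∣u ← find (divides (binom u v) (sameFiber⇒toricBinomial u v u~v) u (initial-binom v≺u))
      with γ , ≡.refl ← ∣ₘ⇒⊕ {p = β} {u} β∣u
      with q , dβ , dq , β~q , q≺β ← initial-move {g} (All.lookup quads g∈Gb) (All.lookup Gb⊆I g∈Gb) β-initial
      = (β , q , γ , dβ , dq , β~q , ≡.refl , ≡.refl) ◅ continue
      where
      smaller : (γ ⊕ q) ≺ (γ ⊕ β)
      smaller = ≡.subst₂ _≺_ (⊕-comm q γ) (⊕-comm β γ) (compatible q β γ q≺β)
      same : SameFiber (γ ⊕ q) v
      same = sameFiber-trans {γ ⊕ q} {γ ⊕ β} {v} (sameFiber-⊕ γ {q} {β} (sameFiber-sym {β} {q} β~q)) u~v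
      continue : Connected (γ ⊕ q) v
      -- The larger of the two monomials is reduced next. Both lie below `u`, so the recursion is
      -- well founded in either case.
      continue with compare (γ ⊕ q) v
      ... | tri< lt _ _     = connected-sym (reduce quads gb (rs v≺u) lt (sameFiber-sym {γ ⊕ q} {v} same))
      ... | tri≈ _ ≡.refl _ = ε
      ... | tri> _ _ gt     = reduce quads gb (rs smaller) gt same

  groebner⇒connected : HasQuadraticGroebnerBasis → FibersConnected
  groebner⇒connected (O , Gb , quads , gb) u v u~v
    with IsStrictTotalOrder.compare (MonomialOrder.isStrictTotalOrder O) u v
  ... | tri< u≺v _ _    = connected-sym (reduce O quads gb (MonomialOrder.wellFounded O v) u≺v (sameFiber-sym {u} {v} u~v))
  ... | tri≈ _ ≡.refl _ = ε
  ... | tri> _ _ v≺u    = reduce O quads gb (MonomialOrder.wellFounded O u) v≺u u~v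

-- Monomial orders and quadratic Gröbner bases

𝟙 : Bool → ℕ
𝟙 true  = 1
𝟙 false = 0

δ : ∀ {n} → Fin n → Fin n → ℕ
δ c i = 𝟙 (does (c Fin.≟ i))

δ-refl : ∀ {n} (c : Fin n) → δ c c ≡ 1
δ-refl c = ≡.cong 𝟙 (dec-true (c Fin.≟ c) ≡.refl)

δ-≢ : ∀ {n} {c i : Fin n} → c ≢ i → δ c i ≡ 0
δ-≢ {c = c} {i} c≢i = ≡.cong 𝟙 (dec-false (c Fin.≟ i) c≢i)

𝟘 : ∀ {N} → Monomial N
𝟘 = Vec.replicate _ 0

var : ∀ {N} → Fin N → Monomial N
var zero    = 1 ∷ 𝟘
var (suc c) = 0 ∷ var c

⊕-identityʳ : ∀ {N} (u : Monomial N) → u ⊕ 𝟘 ≡ u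
⊕-identityʳ = Vecₚ.zipWith-identityʳ ℕₚ.+-identityʳ

lookup-var : ∀ {N} (c i : Fin N) → lookup (var c) i ≡ δ c i
lookup-var zero    zero    = ≡.refl
lookup-var zero    (suc i) = Vecₚ.lookup-replicate i 0
lookup-var (suc c) zero    = ≡.refl
lookup-var (suc c) (suc i) = lookup-var c i

deg-⊕ : ∀ {N} (u v : Monomial N) → deg (u ⊕ v) ≡ deg u ℕ.+ deg v
deg-⊕ []      []      = ≡.refl
deg-⊕ (x ∷ u) (y ∷ v) = ≡.trans (≡.cong (x ℕ.+ y ℕ.+_) (deg-⊕ u v)) (interchange x y (deg u) (deg v))
  where open Algebra.Properties.CommutativeSemigroup ℕₚ.+-commutativeSemigroup using (interchange)

deg-𝟘 : ∀ N → deg (𝟘 {N}) ≡ 0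
deg-𝟘 zero    = ≡.refl
deg-𝟘 (suc N) = deg-𝟘 N

deg-var : ∀ {N} (c : Fin N) → deg (var c) ≡ 1
deg-var {suc N} zero = ≡.cong suc (deg-𝟘 N)
deg-var (suc c)      = deg-var c

deg-var² : ∀ {N} (a b : Fin N) → deg (var a ⊕ var b) ≡ 2
deg-var² a b = ≡.trans (deg-⊕ (var a) (var b)) (≡.cong₂ ℕ._+_ (deg-var a) (deg-var b))

deg≡0⇒𝟘 : ∀ {N} (u : Monomial N) → deg u ≡ 0 → u ≡ 𝟘
deg≡0⇒𝟘 []         _  = ≡.refl
deg≡0⇒𝟘 (zero ∷ u) eq = ≡.cong (0 ∷_) (deg≡0⇒𝟘 u eq)

deg≡suc⇒var : ∀ {N} (u : Monomial N) {k} → deg u ≡ suc k → ∃ λ c → ∃ λ v → u ≡ var c ⊕ v × deg v ≡ k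
deg≡suc⇒var (zero ∷ u) eq with c , v , ≡.refl , dv ← deg≡suc⇒var u eq = suc c , 0 ∷ v , ≡.refl , dv
deg≡suc⇒var (suc x ∷ u) eq = zero , x ∷ u ,
  ≡.cong (suc x ∷_) (≡.sym (≡.trans (⊕-comm 𝟘 u) (⊕-identityʳ u))) , ℕₚ.suc-injective eq

deg≡2⇒var² : ∀ {N} (u : Monomial N) → deg u ≡ 2 → ∃ λ a → ∃ λ b → u ≡ var a ⊕ var b
deg≡2⇒var² u du
  with a , v , ≡.refl , dv ← deg≡suc⇒var u du
  with b , w , ≡.refl , dw ← deg≡suc⇒var v dv
  with ≡.refl ← deg≡0⇒𝟘 w dw = a , b , ≡.cong (var a ⊕_) (⊕-identityʳ (var b))

module FunctionalOrder {N : ℕ} where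

  Functional : Set
  Functional = Monomial N → ℕ

  Additive : Functional → Set
  Additive φ = ∀ u v → φ (u ⊕ v) ≡ φ u ℕ.+ φ v

  Less : List Functional → Monomial N → Monomial N → Set
  Less []      u v = ⊥
  Less (φ ∷ L) u v = φ u ℕ.< φ v ⊎ (φ u ≡ φ v × Less L u v)

  less-trans : ∀ L {u v w} → Less L u v → Less L v w → Less L u w
  less-trans (φ ∷ L) (inj₁ p)       (inj₁ q)       = inj₁ (ℕₚ.<-trans p q)
  less-trans (φ ∷ L) (inj₁ p)       (inj₂ (e , _)) = inj₁ (ℕₚ.<-≤-trans p (ℕₚ.≤-reflexive e))
  less-trans (φ ∷ L) (inj₂ (e , _)) (inj₁ q)       = inj₁ (ℕₚ.≤-<-trans (ℕₚ.≤-reflexive e) q)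
  less-trans (φ ∷ L) (inj₂ (e , p)) (inj₂ (f , q)) = inj₂ (≡.trans e f , less-trans L p q)

  less-irrefl : ∀ L {u} → ¬ Less L u u
  less-irrefl (φ ∷ L) (inj₁ p)       = ℕₚ.n≮n _ p
  less-irrefl (φ ∷ L) (inj₂ (_ , p)) = less-irrefl L p

  less-total : ∀ L u v → Less L u v ⊎ All (λ φ → φ u ≡ φ v) L ⊎ Less L v u
  less-total []      u v = inj₂ (inj₁ [])
  less-total (φ ∷ L) u v with ℕₚ.<-cmp (φ u) (φ v)
  ... | tri< p _ _ = inj₁ (inj₁ p)
  ... | tri> _ _ p = inj₂ (inj₂ (inj₁ p))
  ... | tri≈ _ e _ with less-total L u v
  ...   | inj₁ p         = inj₁ (inj₂ (e , p))
  ...   | inj₂ (inj₁ es) = inj₂ (inj₁ (e ∷ es))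
  ...   | inj₂ (inj₂ p)  = inj₂ (inj₂ (inj₂ (≡.sym e , p)))

  less-wellFounded : ∀ L → WellFounded (Less L)
  less-wellFounded []      = λ u → acc λ ()
  less-wellFounded (φ ∷ L) = On.wellFounded (λ u → φ u , u) (×-wellFounded <-wellFounded (less-wellFounded L))

  less-⊕ : ∀ {L} → All Additive L → ∀ {u v} γ → Less L u v → Less L (u ⊕ γ) (v ⊕ γ)
  less-⊕ {φ ∷ L} (add ∷ adds) {u} {v} γ (inj₁ p) = inj₁
    (≡.subst₂ ℕ._<_ (≡.sym (add u γ)) (≡.sym (add v γ)) (ℕₚ.+-monoˡ-< (φ γ) p))
  less-⊕ {φ ∷ L} (add ∷ adds) {u} {v} γ (inj₂ (e , p)) = inj₂
    (≡.trans (add u γ) (≡.trans (≡.cong (ℕ._+ φ γ) e) (≡.sym (add v γ))) , less-⊕ adds γ p)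

  module _ {c ℓ} (K : Field c ℓ) where
    open Polynomials K N using (MonomialOrder)

    functionalOrder : ∀ L → All Additive L → (∀ {u v} → All (λ φ → φ u ≡ φ v) L → u ≡ v) → MonomialOrder
    functionalOrder L additive separates = record
      { _≺_ = Less L
      ; isStrictTotalOrder = record
        { isStrictPartialOrder = record
          { isEquivalence = ≡.isEquivalence
          ; irrefl        = λ { ≡.refl → less-irrefl L }
          ; trans         = less-trans L
          ; <-resp-≈      = (λ { ≡.refl p → p }) , (λ { ≡.refl p → p })
          }
        ; compare = compare
        }
      ; wellFounded = less-wellFounded L
      ; compatible  = λ _ _ γ p → less-⊕ additive γ p
      }
      where
      compare : Trichotomous _≡_ (Less L)
      compare u v with less-total L u v
      ... | inj₁ p = tri< p (λ { ≡.refl → less-irrefl L p }) (λ q → less-irrefl L (less-trans L p q))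
      ... | inj₂ (inj₂ p) = tri> (λ q → less-irrefl L (less-trans L p q)) (λ { ≡.refl → less-irrefl L p }) p
      ... | inj₂ (inj₁ es) with ≡.refl ← separates es = tri≈ (less-irrefl L) ≡.refl (less-irrefl L)

    -- The exponents, compared lexicographically, break the ties of the weight and separate
    -- monomials. All these functionals take values in ℕ, which makes the order well founded.
    weightOrder : ∀ ω → Additive ω → MonomialOrder
    weightOrder ω additive = functionalOrder (ω ∷ List.map exponent (List.allFin N))
      (additive ∷ Allₚ.map⁺ (All.universal (λ i u v → lookup-⊕ u v i) _))
      (λ { (_ ∷ es) → ≗⇒≡ λ i → All.lookup es (∈-map⁺ exponent (∈-allFin i)) })
      where
      exponent : Fin N → Functional
      exponent i u = lookup u i

-- Gröbner bases from unique irreducible monomials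

module QuadraticGroebner {c ℓ} (K : Field c ℓ) {n N : ℕ} (A : Matrix n N)
  (O : Polynomials.MonomialOrder K N) where
  open Field K hiding (zero)
  open Toric K A
  open Fibers A
  open Evaluation K N
  open ToricConnectivity K A
  open MonomialOrder O
  open IsStrictTotalOrder isStrictTotalOrder using (compare; irrefl; _<?_) renaming (trans to ≺-trans)
  open Algebra.Properties.Ring ring using (-0#≈0#; -‿involutive)
  open Relation.Binary.Reasoning.Setoid setoid

  Quadruple : Set
  Quadruple = (Fin N × Fin N) × (Fin N × Fin N)

  lead trail : Quadruple → Monomial N
  lead  ((a , b) , _) = var a ⊕ var b
  trail (_ , (c , d)) = var c ⊕ var d

  Descent : Quadruple → Set
  Descent q = SameFiber (lead q) (trail q) × trail q ≺ lead q

  descent? : ∀ q → Dec (Descent q)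
  descent? q = sameFiber? (lead q) (trail q) ×-dec (trail q <? lead q)

  -- A descent is a quadratic toric binomial with initial monomial `lead`, so this is divisibility
  -- by an initial monomial of the candidate basis.
  Reducible : Monomial N → Set
  Reducible u = ∃ λ q → Descent q × lead q ∣ₘ u

  pairs : List (Fin N × Fin N)
  pairs = List.cartesianProduct (List.allFin N) (List.allFin N)

  descents : List Quadruple
  descents = List.filter descent? (List.cartesianProduct pairs pairs)

  ∈-descents : ∀ {q} → Descent q → q ∈ descents
  ∈-descents = ∈-filter⁺ descent? (∈-cartesianProduct⁺
    (∈-cartesianProduct⁺ (∈-allFin _) (∈-allFin _)) (∈-cartesianProduct⁺ (∈-allFin _) (∈-allFin _)))

  all-descents : All Descent descents
  all-descents = Allₚ.all-filter descent? (List.cartesianProduct pairs pairs)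

  poly : Quadruple → Poly
  poly q = binom (lead q) (trail q)

  module _ (unique : ∀ u v → SameFiber u v → u ≢ v → Reducible u ⊎ Reducible v) where

    -- Any other monomial of the fiber is reducible by `unique`, hence has a smaller one below it in
    -- the fiber; the descent can stop only at `α`.
    irreducible⇒least : ∀ {α} → ¬ Reducible α → ∀ β → SameFiber α β → β ≢ α → α ≺ β
    irreducible⇒least {α} irr β = go β (wellFounded β)
      where
      go : ∀ β → Acc _≺_ β → SameFiber α β → β ≢ α → α ≺ β
      go β (acc rs) α~β β≢α with unique α β α~β (β≢α ∘ ≡.sym)
      ... | inj₁ red = contradiction red irr
      ... | inj₂ (q , (lead~trail , trail≺lead) , lead∣β) with γ , ≡.refl ← ∣ₘ⇒⊕ {p = lead q} {β} lead∣β = continue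
        where
        smaller : (γ ⊕ trail q) ≺ (γ ⊕ lead q)
        smaller = ≡.subst₂ _≺_ (⊕-comm (trail q) γ) (⊕-comm (lead q) γ) (compatible (trail q) (lead q) γ trail≺lead)
        continue : α ≺ β
        continue with (γ ⊕ trail q) ≟ₘ α
        ... | yes ≡.refl = smaller
        ... | no ≢α = ≺-trans (go (γ ⊕ trail q) (rs smaller)
              (sameFiber-trans {α} {γ ⊕ lead q} {γ ⊕ trail q} α~β (sameFiber-⊕ γ {lead q} {trail q} lead~trail)) ≢α) smaller

    -- The sum of the coefficients of f over the fiber of its initial monomial α vanishes; if α
    -- were irreducible, it would be least in its fiber and so the only monomial contributing.
    initial-reducible : ∀ f → ToricIdeal f → ∀ α → IsInitial O f α → ¬ ¬ Reducible α
    initial-reducible f f∈I α (α≉0 , initial) irr = ¬¬All f′ stable λ vanish → α≉0 (begin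
        coeff f α       ≈⟨ -‿involutive _ ⟨
        - - coeff f α   ≈⟨ -‿cong (begin
          - coeff f α                       ≈⟨ trans (+-identityʳ _) (trans (*-congˡ (indicator-yes (sameFiber? α α) λ r → ≡.refl)) (*-identityʳ _)) ⟨
          ev F correction                   ≈⟨ +-identityˡ _ ⟨
          0# + ev F correction              ≈⟨ +-congʳ (ev-toric F (fiberIndicator-resp α) f f∈I) ⟨
          ev F f + ev F correction          ≈⟨ ev-++ F f correction ⟨
          ev F f′                           ≈⟨ ev-vanishes F f′ vanish ⟩
          0#                                ∎) ⟩
        - 0#            ≈⟨ -0#≈0# ⟩
        0#              ∎)
      where
      F : Monomial N → Carrier
      F β = indicator (sameFiber? α β)
      correction f′ : Poly
      -- Subtracting the initial term makes the coefficient at `α` vanish, so `ev-vanishes` can be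
      -- applied to the whole of `f′`.
      correction = (- coeff f α , α) ∷ []
      f′ = f ++ correction
      -- Whether a coefficient vanishes is not decided, so each term is settled only up to double
      -- negation. This passes through the finite list, and the goal, being absurdity, absorbs it.
      ¬¬All : ∀ {q} {Q : Carrier × Monomial N → Set q} ts → (∀ t → ¬ ¬ Q t) → ¬ ¬ All Q ts
      ¬¬All []       _  k = k []
      ¬¬All (t ∷ ts) ¬¬Q k = ¬¬Q t λ q → ¬¬All ts ¬¬Q λ qs → k (q ∷ qs)
      coeff-f′ : ∀ β → coeff f′ β ≈ coeff f β + - coeff f α * indicator (α ≟ₘ β)
      coeff-f′ β = trans (coeff-++ f correction β) (+-congˡ (trans (coeff≈ev correction β) (+-identityʳ _)))
      coeff-f′-α : coeff f′ α ≈ 0#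
      coeff-f′-α = trans (coeff-f′ α) (trans (+-congˡ (trans (*-congˡ (indicator-yes (α ≟ₘ α) ≡.refl)) (*-identityʳ _))) (-‿inverseʳ _))
      coeff-f′-other : ∀ {β} → α ≢ β → coeff f′ β ≈ coeff f β
      coeff-f′-other {β} α≢β = trans (coeff-f′ β) (trans (+-congˡ (trans (*-congˡ (indicator-no (α ≟ₘ β) α≢β)) (zeroʳ _))) (+-identityʳ _))
      stable : ∀ t → ¬ ¬ (coeff f′ (proj₂ t) * F (proj₂ t) ≈ 0#)
      stable (_ , β) = cases (α ≟ₘ β) (sameFiber? α β)
        where
        cases : Dec (α ≡ β) → Dec (SameFiber α β) → ¬ ¬ (coeff f′ β * F β ≈ 0#)
        cases (yes ≡.refl) _ k = k (trans (*-congʳ coeff-f′-α) (zeroˡ _))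
        cases (no _) (no ¬α~β) k = k (trans (*-congˡ (indicator-no (sameFiber? α β) ¬α~β)) (zeroʳ _))
        cases (no α≢β) (yes α~β) k with initial β (λ ≈0 → k (trans (*-congʳ (trans (coeff-f′-other α≢β) ≈0)) (zeroˡ _)))
        ... | inj₁ β≡α = α≢β (≡.sym β≡α)
        ... | inj₂ β≺α = irrefl ≡.refl (≺-trans β≺α (irreducible⇒least irr β α~β (α≢β ∘ ≡.sym)))

    hasQuadraticGroebnerBasis : HasQuadraticGroebnerBasis
    hasQuadraticGroebnerBasis = O , List.map poly descents ,
      Allₚ.map⁺ (All.map (λ {q} _ → lead q , trail q , deg-lead q , deg-trail q , λ _ → refl) all-descents) ,
      Allₚ.map⁺ (All.map (λ {q} d → sameFiber⇒toricBinomial (lead q) (trail q) (proj₁ d)) all-descents) ,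
      divides
      where
      deg-lead : ∀ q → deg (lead q) ≡ 2
      deg-lead ((a , b) , _) = deg-var² a b
      deg-trail : ∀ q → deg (trail q) ≡ 2
      deg-trail (_ , (a , b)) = deg-var² a b
      divides : ∀ f → ToricIdeal f → ∀ α → IsInitial O f α →
        Any (λ g → Σ (Monomial N) λ β → IsInitial O g β × (β ∣ₘ α)) (List.map poly descents)
      -- The list of descents is finite and divisibility is decidable, so the double negation
      -- disappears here.
      divides f f∈I α α-initial with Any.any? (λ q → Finₚ.all? (λ i → lookup (lead q) i ℕ.≤? lookup α i)) descents
      ... | no none = ⊥-elim (initial-reducible f f∈I α α-initial λ { (q , d , lead∣α) → none (lose (∈-descents d) lead∣α) })
      ... | yes some with q , q∈ , lead∣α ← find some =
        lose (∈-map⁺ poly q∈) (lead q , initial-binom O (proj₂ (All.lookup all-descents q∈)) , lead∣α)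

-- Doubly lexical orderings

open import Algebra.Properties.Semiring.Sum ℕₚ.+-*-semiring using (sum; sum-cong-≗; ∑-distrib-+; *-distribˡ-sum; sum-permute)
open import Data.Nat using (_+_; _*_; _∸_; _^_; _≤_; _<_)
open import Relation.Binary.PropositionalEquality using (refl; sym; trans; cong; cong₂; subst; subst₂; ≢-sym; module ≡-Reasoning)

sum-zero : ∀ {n} {f : Fin n → ℕ} → (∀ i → f i ≡ 0) → sum f ≡ 0
sum-zero {zero}  f≡0 = refl
sum-zero {suc n} f≡0 = cong₂ _+_ (f≡0 zero) (sum-zero (f≡0 ∘ suc))

sum-mono : ∀ {n} {f g : Fin n → ℕ} → (∀ i → f i ≤ g i) → sum f ≤ sum g
sum-mono {zero}  f≤g = z≤n
sum-mono {suc n} f≤g = ℕₚ.+-mono-≤ (f≤g zero) (sum-mono (f≤g ∘ suc))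

sum-δ : ∀ {n} (c : Fin n) (f : Fin n → ℕ) → sum (λ i → f i * δ c i) ≡ f c
sum-δ zero f = begin
  f zero * 1 + sum (λ i → f (suc i) * 0) ≡⟨ cong₂ _+_ (ℕₚ.*-identityʳ _) (sum-zero (λ i → ℕₚ.*-zeroʳ (f (suc i)))) ⟩
  f zero + 0                             ≡⟨ ℕₚ.+-identityʳ _ ⟩
  f zero                                 ∎
  where open ≡-Reasoning
sum-δ (suc c) f = cong₂ _+_ (ℕₚ.*-zeroʳ (f zero)) (sum-δ c (f ∘ suc))

-- A binary number with column zero as its lowest digit: comparing rows as numbers is comparing them
-- lexicographically from the last column.
row : ∀ {n} → (Fin n → Bool) → ℕ
row f = sum (λ j → 𝟙 (f j) * 2 ^ toℕ j)

row-suc : ∀ {n} (f : Fin (suc n) → Bool) → row f ≡ 𝟙 (f zero) + 2 * row (f ∘ suc)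
row-suc f = cong₂ _+_ (ℕₚ.*-identityʳ (𝟙 (f zero)))
  (trans (sum-cong-≗ (λ j → lem (𝟙 (f (suc j))) (2 ^ toℕ j)))
         (sym (*-distribˡ-sum 2 (λ j → 𝟙 (f (suc j)) * 2 ^ toℕ j))))
  where
  lem : ∀ x y → x * (2 * y) ≡ 2 * (x * y)
  lem = solve-∀

row-cong : ∀ {n} {f g : Fin n → Bool} → (∀ i → f i ≡ g i) → row f ≡ row g
row-cong f≡g = sum-cong-≗ (λ j → cong (λ x → 𝟙 x * 2 ^ toℕ j) (f≡g j))

Increases : ∀ {n} → (f g : Fin n → Bool) → Set
Increases f g = ∃ λ c → f c ≡ false × g c ≡ true × (∀ d → c Fin.< d → f d ≡ g d)

𝟙≤1 : ∀ x → 𝟙 x ≤ 1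
𝟙≤1 true  = s≤s z≤n
𝟙≤1 false = z≤n

high-≤ : ∀ {x y X Y} → y ≤ 1 → x + 2 * X ≤ y + 2 * Y → X ≤ Y
high-≤ {x} {y} {X} {Y} y≤1 le = ℕₚ.≮⇒≥ λ Y<X → ℕₚ.<-irrefl refl (begin-strict
  y + 2 * Y     ≤⟨ ℕₚ.+-monoˡ-≤ (2 * Y) y≤1 ⟩
  1 + 2 * Y     <⟨ ℕₚ.n<1+n _ ⟩
  2 + 2 * Y     ≡⟨ ℕₚ.*-suc 2 Y ⟨
  2 * suc Y     ≤⟨ ℕₚ.*-monoʳ-≤ 2 Y<X ⟩
  2 * X         ≤⟨ ℕₚ.m≤n+m _ x ⟩
  x + 2 * X     ≤⟨ le ⟩
  y + 2 * Y     ∎)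
  where open ℕₚ.≤-Reasoning

-- The induction strips the lowest digit, which decides only if all higher digits agree.
row-≤⇒lex : ∀ {n} (f g : Fin n → Bool) → row f ≤ row g → (∀ i → f i ≡ g i) ⊎ Increases f g
row-≤⇒lex {zero} f g _ = inj₁ λ ()
row-≤⇒lex {suc n} f g le
  with le′ ← ℕₚ.≤-trans (ℕₚ.≤-reflexive (sym (row-suc f))) (ℕₚ.≤-trans le (ℕₚ.≤-reflexive (row-suc g)))
  with row-≤⇒lex (f ∘ suc) (g ∘ suc) (high-≤ {𝟙 (f zero)} (𝟙≤1 (g zero)) le′)
... | inj₂ (c , fc , gc , agree) = inj₂ (suc c , fc , gc , λ { (suc d) (s≤s c<d) → agree d c<d })
... | inj₁ tail≡ with f zero in f₀ | g zero in g₀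
...   | true  | true  = inj₁ λ { zero → trans f₀ (sym g₀) ; (suc i) → tail≡ i }
...   | false | false = inj₁ λ { zero → trans f₀ (sym g₀) ; (suc i) → tail≡ i }
...   | false | true  = inj₂ (zero , f₀ , g₀ , λ { (suc d) _ → tail≡ d })
...   | true  | false = contradiction
        (ℕₚ.≤-trans le′ (ℕₚ.≤-reflexive (cong (2 *_) (sym (row-cong tail≡))))) (ℕₚ.n≮n _)

module DoublyLexical {n : ℕ} (b : Fin n → Fin n → Bool)
  (b-refl : ∀ i → b i i ≡ true) (b-sym : ∀ i j → b i j ≡ b j i) where

  LexSorted : (Fin n ↔ Fin n) → Set
  LexSorted σ = ∀ i j → i Fin.< j →
    row (λ k → b (σ ⟨$⟩ʳ i) (σ ⟨$⟩ʳ k)) ≤ row (λ k → b (σ ⟨$⟩ʳ j) (σ ⟨$⟩ʳ k))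

  module _ (σ : Fin n ↔ Fin n) where
    B : Fin n → Fin n → ℕ
    B i j = 𝟙 (b (σ ⟨$⟩ʳ i) (σ ⟨$⟩ʳ j))

    app : (Fin n → ℕ) → Fin n → ℕ
    app p i = sum (λ j → B i j * p j)

    form : (Fin n → ℕ) → ℕ
    form p = sum (λ i → p i * app p i)

    app-δ : ∀ q d c i → app (λ j → q j + d * δ c j) i ≡ app q i + d * B i c
    app-δ q d c i = begin
      sum (λ j → B i j * (q j + d * δ c j))
        ≡⟨ sum-cong-≗ (λ j → lem (B i j) (q j) d (δ c j)) ⟩
      sum (λ j → B i j * q j + d * B i j * δ c j)
        ≡⟨ ∑-distrib-+ (λ j → B i j * q j) (λ j → d * B i j * δ c j) ⟩
      app q i + sum (λ j → d * B i j * δ c j)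
        ≡⟨ cong (app q i +_) (sum-δ c (λ j → d * B i j)) ⟩
      app q i + d * B i c ∎
      where
      open ≡-Reasoning
      lem : ∀ x y d e → x * (y + d * e) ≡ x * y + d * x * e
      lem = solve-∀

    -- The quadratic form of `B` is expanded at `q` plus `d` times a unit vector: symmetry merges
    -- the two mixed terms, and the diagonal entry one gives `d * d`.
    form-δ : ∀ q d c → form (λ j → q j + d * δ c j) ≡ form q + (2 * d * app q c + d * d)
    form-δ q d c = begin
      sum (λ i → (q i + d * δ c i) * app (λ j → q j + d * δ c j) i)
        ≡⟨ sum-cong-≗ (λ i → trans (cong ((q i + d * δ c i) *_) (app-δ q d c i))
                                   (lem (q i) d (δ c i) (app q i) (B i c))) ⟩
      sum (λ i → q i * app q i + (d * (B i c * q i) + d * (app q i + d * B i c) * δ c i))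
        ≡⟨ ∑-distrib-+ (λ i → q i * app q i) _ ⟩
      form q + sum (λ i → d * (B i c * q i) + d * (app q i + d * B i c) * δ c i)
        ≡⟨ cong (form q +_) (∑-distrib-+ (λ i → d * (B i c * q i)) _) ⟩
      form q + (sum (λ i → d * (B i c * q i)) + sum (λ i → d * (app q i + d * B i c) * δ c i))
        ≡⟨ cong (form q +_) (cong₂ _+_
             (trans (sym (*-distribˡ-sum d (λ i → B i c * q i)))
                    (cong (d *_) (sum-cong-≗ (λ i → cong (λ x → 𝟙 x * q i) (b-sym _ _)))))
             (sum-δ c (λ i → d * (app q i + d * B i c)))) ⟩
      form q + (d * app q c + d * (app q c + d * B c c))
        ≡⟨ cong (λ x → form q + (d * app q c + d * (app q c + d * 𝟙 x))) (b-refl _) ⟩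
      form q + (d * app q c + d * (app q c + d * 1))
        ≡⟨ cong (form q +_) (lem′ d (app q c)) ⟩
      form q + (2 * d * app q c + d * d) ∎
      where
      open ≡-Reasoning
      lem : ∀ x d e y z → (x + d * e) * (y + d * z) ≡ x * y + (d * (z * x) + d * (y + d * z) * e)
      lem = solve-∀
      lem′ : ∀ d x → d * x + d * (x + d * 1) ≡ 2 * d * x + d * d
      lem′ = solve-∀

    form-cong : ∀ {p q} → (∀ i → p i ≡ q i) → form p ≡ form q
    form-cong p≡q = sum-cong-≗ λ i → cong₂ _*_ (p≡q i) (sum-cong-≗ λ j → cong (B i j *_) (p≡q j))

  w : Fin n → ℕ
  w i = 2 ^ toℕ i

  potential : (Fin n ↔ Fin n) → ℕ
  potential σ = form σ w

  -- Exchanging two vertices in the ordering amounts to keeping the matrix and exchanging their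
  -- weights, so both potentials become values of one quadratic form.
  potential-transpose : ∀ σ i j → potential (transpose i j ∘ₚ σ) ≡ form σ (w ∘ PC.transpose j i)
  potential-transpose σ i j = sym (begin
    sum (λ k → w (s′ k) * sum (λ l → B σ k l * w (s′ l)))
      ≡⟨ sum-permute _ (transpose i j) ⟩
    sum (λ k → w (s′ (s k)) * sum (λ l → B σ (s k) l * w (s′ l)))
      ≡⟨ sum-cong-≗ (λ k → cong₂ _*_ (w∘s k)
           (trans (sum-permute (λ l → B σ (s k) l * w (s′ l)) (transpose i j))
                  (sum-cong-≗ (λ l → cong (B σ (s k) (s l) *_) (w∘s l))))) ⟩
    sum (λ k → w k * sum (λ l → B σ (s k) (s l) * w l)) ∎)
    where
    open ≡-Reasoning
    s = PC.transpose i j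
    s′ = PC.transpose j i
    w∘s : ∀ k → w (s′ (s k)) ≡ w k
    w∘s k = cong w (PC.transpose-inverse j i {k})

  -- Let q be the weights w with w j lowered to w i.  Then the old weights are q + d·δ j and the
  -- exchanged ones q + d·δ i, where d = w j − w i.
  potential-increases : ∀ σ i j → i Fin.< j → app σ w j < app σ w i →
    potential σ < potential (transpose i j ∘ₚ σ)
  potential-increases σ i j i<j wj<wi = begin-strict
    potential σ                           ≡⟨ form-cong σ w≡ ⟩
    form σ (λ k → q k + d * δ j k)        ≡⟨ form-δ σ q d j ⟩
    form σ q + (2 * d * app σ q j + d * d) <⟨ ℕₚ.+-monoʳ-< (form σ q) (ℕₚ.+-monoˡ-< (d * d) (mul< d>0 qj<qi)) ⟩
    form σ q + (2 * d * app σ q i + d * d) ≡⟨ form-δ σ q d i ⟨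
    form σ (λ k → q k + d * δ i k)        ≡⟨ form-cong σ s≡ ⟨
    form σ (w ∘ PC.transpose j i)         ≡⟨ potential-transpose σ i j ⟨
    potential (transpose i j ∘ₚ σ)        ∎
    where
    open ℕₚ.≤-Reasoning
    i≢j : i ≢ j
    i≢j = Finₚ.<⇒≢ i<j
    wi<wj : w i < w j
    wi<wj = ℕₚ.^-monoʳ-< 2 (s≤s (s≤s z≤n)) i<j
    d = w j ∸ w i
    d>0 : 0 < d
    d>0 = ℕₚ.m<n⇒0<n∸m wi<wj
    wj : w j ≡ w i + d
    wj = sym (ℕₚ.m+[n∸m]≡n (ℕₚ.<⇒≤ wi<wj))
    q : Fin n → ℕ
    q k with k Fin.≟ j
    ... | yes _ = w i
    ... | no  _ = w k
    w≡ : ∀ k → w k ≡ q k + d * δ j k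
    w≡ k with k Fin.≟ j
    ... | yes refl rewrite δ-refl k = trans wj (cong (w i +_) (sym (ℕₚ.*-identityʳ d)))
    ... | no k≢j rewrite δ-≢ (k≢j ∘ sym) = sym (trans (cong (w k +_) (ℕₚ.*-zeroʳ d)) (ℕₚ.+-identityʳ _))
    s≡ : ∀ k → w (PC.transpose j i k) ≡ q k + d * δ i k
    s≡ k with k Fin.≟ j
    ... | yes refl rewrite δ-≢ i≢j = sym (trans (cong (w i +_) (ℕₚ.*-zeroʳ d)) (ℕₚ.+-identityʳ _))
    ... | no k≢j with k Fin.≟ i
    ...   | yes refl rewrite δ-refl k = trans wj (cong (w k +_) (sym (ℕₚ.*-identityʳ d)))
    ...   | no k≢i rewrite δ-≢ (k≢i ∘ sym) = sym (trans (cong (w k +_) (ℕₚ.*-zeroʳ d)) (ℕₚ.+-identityʳ _))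
    app≡ : ∀ k → app σ w k ≡ app σ q k + d * B σ k j
    app≡ k = trans (sum-cong-≗ (λ l → cong (B σ k l *_) (w≡ l))) (app-δ σ q d j k)
    -- Lowering the weight of `j` by `d` takes exactly `d` from row `j`, whose diagonal entry is
    -- one, and at most `d` from row `i`.
    qj<qi : app σ q j < app σ q i
    qj<qi = ℕₚ.+-cancelʳ-< (d * 1) _ _ (begin-strict
      app σ q j + d * 1         ≡⟨ cong (λ x → app σ q j + d * 𝟙 x) (b-refl _) ⟨
      app σ q j + d * B σ j j   ≡⟨ app≡ j ⟨
      app σ w j                 <⟨ wj<wi ⟩
      app σ w i                 ≡⟨ app≡ i ⟩
      app σ q i + d * B σ i j   ≤⟨ ℕₚ.+-monoʳ-≤ (app σ q i) (ℕₚ.*-monoʳ-≤ d (𝟙≤1 _)) ⟩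
      app σ q i + d * 1         ∎)
    mul< : ∀ {d x y} → 0 < d → x < y → 2 * d * x < 2 * d * y
    mul< {suc d} _ x<y = ℕₚ.*-monoʳ-< (2 * suc d) x<y

  potential-bounded : ∀ σ → potential σ ≤ sum (λ i → w i * sum w)
  potential-bounded σ = sum-mono λ i → ℕₚ.*-monoʳ-≤ (w i) (sum-mono λ j →
    ℕₚ.≤-trans (ℕₚ.*-monoˡ-≤ (w j) (𝟙≤1 (b (σ ⟨$⟩ʳ i) (σ ⟨$⟩ʳ j)))) (ℕₚ.≤-reflexive (ℕₚ.*-identityˡ (w j))))

  -- Exchanging an inverted pair raises the bounded potential, so the ascent ends. As `app σ w i`
  -- unfolds to the `row` of `i`, it ends at a sorted ordering.
  lexSorted-exists : ∃ LexSorted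
  lexSorted-exists = ascend Perm.id (<-wellFounded _)
    where
    ascend : ∀ σ → Acc _<_ (sum (λ i → w i * sum w) ∸ potential σ) → ∃ LexSorted
    ascend σ (acc rs) with Finₚ.any? (λ i → Finₚ.any? (λ j →
      (i Finₚ.<? j) ×-dec (app σ w j ℕₚ.<? app σ w i)))
    ... | yes (i , j , i<j , wj<wi) = ascend (transpose i j ∘ₚ σ)
            (rs (ℕₚ.∸-monoʳ-< (potential-increases σ i j i<j wj<wi) (potential-bounded (transpose i j ∘ₚ σ))))
    ... | no none = σ , λ i j i<j → ℕₚ.≮⇒≥ λ lt → none (i , j , i<j , lt)

-- Elimination orderings from rigid fibers

Pair : ℕ → Set
Pair n = Fin n × Fin n

total : ∀ {n} → (Fin n → ℕ) → List (Pair n) → ℕ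
total φ []             = 0
total φ ((x , y) ∷ es) = φ x + φ y + total φ es

SamePair : ∀ {n} → Pair n → Pair n → Set
SamePair (x , y) (s , t) = (x ≡ s × y ≡ t) ⊎ (x ≡ t × y ≡ s)

module Matching {n : ℕ} (b : Fin n → Fin n → Bool) where

  _~_ : Fin n → Fin n → Set
  x ~ y = b x y ≡ true

  Joined : Pair n → Set
  Joined (x , y) = x ~ y

  -- The inequalities exclude the regroupings of the four ends that give the same two edges back.
  Rigid₂ : Pair n → Pair n → Set
  Rigid₂ (x , y) (s , t) =
    ¬ (x ~ s × y ~ t × x ≢ t × y ≢ s) × ¬ (x ~ t × y ~ s × x ≢ s × y ≢ t)

  -- What connectedness of the fibers says about edges and loops: a multiset of them that admits
  -- no quadratic move is alone in its fiber.
  RigidUnique : Set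
  RigidUnique = ∀ es f fs → All Joined es → All Joined (f ∷ fs) →
    (∀ φ → total φ es ≡ total φ (f ∷ fs)) → AllPairs Rigid₂ es → All (¬_ ∘ SamePair f) es → ⊥

-- Chordless cycles and suns in a doubly lexical ordering

module GammaFree {n : ℕ} (b : Fin n → Fin n → Bool)
  (b-refl : ∀ i → b i i ≡ true) (b-sym : ∀ i j → b i j ≡ b j i)
  (lex : ∀ i j → i Fin.< j → row (b i) ≤ row (b j))
  (rigidUnique : Matching.RigidUnique b) where

  open Matching b

  private
    V = Fin n

  ~-sym : ∀ {x y} → x ~ y → y ~ x
  ~-sym x~y = trans (b-sym _ _) x~y

  false⇒≁ : ∀ {x y} → b x y ≡ false → ¬ x ~ y
  false⇒≁ eq eq′ with () ← trans (sym eq) eq′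

  ≁⇒≢ : ∀ {x y} → ¬ x ~ y → x ≢ y
  ≁⇒≢ x≁y refl = x≁y (b-refl _)

  -- Row `j` lacks the entry at `k` that row `i` has, yet it is not smaller as a binary number, so
  -- it must gain at a more significant column; `w` is the last column where the rows differ.
  lex-step : ∀ {i j k} → i Fin.< j → i ~ k → ¬ j ~ k →
    ∃ λ w → k Fin.< w × ¬ i ~ w × j ~ w × (∀ d → w Fin.< d → b i d ≡ b j d)
  lex-step {i} {j} {k} i<j i~k j≁k with row-≤⇒lex (b i) (b j) (lex i j i<j)
  ... | inj₁ same = contradiction (trans (sym (same k)) i~k) j≁k
  ... | inj₂ (w , iw , jw , agree) with Finₚ.<-cmp k w
  ...   | tri< k<w _ _ = w , k<w , false⇒≁ iw , jw , agree
  ...   | tri≈ _ refl _ = contradiction jw j≁k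
  ...   | tri> _ _ w<k = contradiction (trans (sym (agree k w<k)) i~k) j≁k

  loops : List V → List (Pair n)
  loops = List.map (λ x → x , x)

  loops-joined : ∀ xs → All Joined (loops xs)
  loops-joined []       = []
  loops-joined (x ∷ xs) = b-refl x ∷ loops-joined xs

  -- An edge of the growing induced path whose interior vertices are X and whose ends are y and z.
  record PathEdge (X : List V) (y z : V) (e : Pair n) : Set where
    constructor pathEdge
    field
      joined  : Joined e
      proper  : proj₁ e ≢ proj₂ e
      inner   : proj₁ e ∈ X
      outer   : proj₂ e ∈ X ⊎ proj₂ e ≡ y ⊎ proj₂ e ≡ z
      -- These two conditions keep the closing edges `{y , w}` and `{w , z}` rigid against the path
      -- edges at `z` and at `y`.
      beforeZ : proj₂ e ≡ z → ¬ y ~ proj₁ e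
      beforeY : proj₂ e ≡ y → ¬ z ~ proj₁ e

  -- The chordless path grows at both ends in turn by maximal lexicographic differences until
  -- it closes up; the edges of the resulting chordless cycle have the same degrees as its loops.
  no-long-cycle : ∀ X E {x y z} → Acc Fin._>_ z → x Fin.< y → y Fin.< z → x ~ z → ¬ y ~ z →
    (∀ {t} → t ∈ X → ∀ d → z Fin.< d → b t d ≡ b x d) →
    All (PathEdge X y z) E → AllPairs Rigid₂ E →
    (∀ φ → total φ E ≡ total φ (loops X) + (φ y + φ z)) → ⊥
  no-long-cycle X E {x} {y} {z} (acc rs) x<y y<z x~z y≁z agree edges rigid tot
    with w , z<w , x≁w , y~w , agree′ ← lex-step x<y x~z y≁z = finish
    where
    -- The rows of the interior vertices agree with row `x` beyond `z`, so `w`, missed by `x`, is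
    -- missed by all of them.
    X≁w : ∀ {t} → t ∈ X → ¬ w ~ t
    X≁w t∈X w~t = x≁w (trans (sym (agree t∈X w z<w)) (~-sym w~t))
    y≢w : y ≢ w
    y≢w = Finₚ.<⇒≢ (Finₚ.<-trans y<z z<w)
    z≢w : z ≢ w
    z≢w = Finₚ.<⇒≢ z<w
    rigid-yw : (w ~ z → ∀ {e} → PathEdge X y z e → proj₂ e ≡ z → ¬ y ~ proj₁ e) →
      ∀ {e} → PathEdge X y z e → Rigid₂ (y , w) e
    rigid-yw at-z {s , t} p@(pathEdge _ _ i o _ _) =
      (λ { (y~s , w~t , y≢t , _) → no-nbr o y~s w~t y≢t }) , (λ { (_ , w~s , _) → X≁w i w~s })
      where
      no-nbr : t ∈ X ⊎ t ≡ y ⊎ t ≡ z → y ~ s → w ~ t → y ≢ t → ⊥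
      no-nbr (inj₁ t∈X)         _   w~t _   = X≁w t∈X w~t
      no-nbr (inj₂ (inj₁ t≡y))  _   _   y≢t = y≢t (sym t≡y)
      no-nbr (inj₂ (inj₂ refl)) y~s w~z _   = at-z w~z p refl y~s
    finish : ⊥
    finish with b w z in wz
    -- The path is extended from `y` to `w`. Then `y` is interior and its row becomes the reference
    -- row, while `z` and `w` are the new ends; the last position has moved up from `z` to `w`.
    ... | false = no-long-cycle (y ∷ X) ((y , w) ∷ E) (rs z<w) y<z z<w y~w (false⇒≁ wz ∘ ~-sym)
          (λ { (here refl) d _ → refl
             ; (there t∈X) d w<d → trans (agree t∈X d (Finₚ.<-trans z<w w<d)) (agree′ d w<d) })
          (pathEdge y~w y≢w (here refl) (inj₂ (inj₂ refl)) (λ _ → y≁z ∘ ~-sym) (λ w≡z → ⊥-elim (z≢w (sym w≡z)))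
            ∷ All.map shift edges)
          (All.map (rigid-yw (λ w~z → contradiction w~z (false⇒≁ wz))) edges ∷ rigid)
          (λ φ → trans (cong (_+_ (φ y + φ w)) (tot φ)) (lem (φ y) (φ w) (φ z) (total φ (loops X))))
      where
      shift : ∀ {e} → PathEdge X y z e → PathEdge (y ∷ X) z w e
      shift (pathEdge j p i o _ _) = pathEdge j p (there i) (outer′ o)
        (λ { refl → ⊥-elim (fresh o) }) (λ _ → X≁w i)
        where
        outer′ : ∀ {t} → t ∈ X ⊎ t ≡ y ⊎ t ≡ z → t ∈ (y ∷ X) ⊎ t ≡ z ⊎ t ≡ w
        outer′ (inj₁ t∈X)         = inj₁ (there t∈X)
        outer′ (inj₂ (inj₁ refl)) = inj₁ (here refl)
        outer′ (inj₂ (inj₂ refl)) = inj₂ (inj₁ refl)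
        fresh : ¬ (w ∈ X ⊎ w ≡ y ⊎ w ≡ z)
        fresh (inj₁ w∈X)         = X≁w w∈X (b-refl w)
        fresh (inj₂ (inj₁ refl)) = y≢w refl
        fresh (inj₂ (inj₂ refl)) = z≢w refl
      lem : ∀ y w z L → y + w + (L + (y + z)) ≡ y + y + L + (z + w)
      lem = solve-∀
    ... | true = rigidUnique ((y , w) ∷ (w , z) ∷ E) (w , w) ((y , y) ∷ (z , z) ∷ loops X)
          (y~w ∷ wz ∷ All.map PathEdge.joined edges)
          (b-refl w ∷ b-refl y ∷ b-refl z ∷ loops-joined X)
          (λ φ → trans (cong (λ T → φ y + φ w + (φ w + φ z + T)) (tot φ))
                       (lem (φ y) (φ w) (φ z) (total φ (loops X))))
          ((((λ { (_ , _ , _ , w≢w) → w≢w refl }) , (λ { (y~z , _) → y≁z y~z }))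
              ∷ All.map (rigid-yw (λ _ → PathEdge.beforeZ)) edges)
            ∷ All.map rigid-wz edges ∷ rigid)
          (not-loop y≢w ∷ not-loop (z≢w ∘ sym) ∷ All.map (not-loop ∘ PathEdge.proper) edges)
      where
      not-loop : ∀ {s t} → s ≢ t → ¬ SamePair (w , w) (s , t)
      not-loop s≢t (inj₁ (refl , refl)) = s≢t refl
      not-loop s≢t (inj₂ (refl , refl)) = s≢t refl
      rigid-wz : ∀ {e} → PathEdge X y z e → Rigid₂ (w , z) e
      rigid-wz {s , t} (pathEdge _ _ i o _ beforeY) =
        (λ { (w~s , _) → X≁w i w~s }) , (λ { (w~t , z~s , _ , z≢t) → no-nbr o z~s w~t z≢t })
        where
        no-nbr : t ∈ X ⊎ t ≡ y ⊎ t ≡ z → z ~ s → w ~ t → z ≢ t → ⊥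
        no-nbr (inj₁ t∈X)        _   w~t _   = X≁w t∈X w~t
        no-nbr (inj₂ (inj₁ t≡y)) z~s _   _   = beforeY t≡y z~s
        no-nbr (inj₂ (inj₂ t≡z)) _   _   z≢t = z≢t (sym t≡z)
      lem : ∀ y w z L → y + w + (w + z + (L + (y + z))) ≡ w + w + (y + y + (z + z + L))
      lem = solve-∀

  -- If `j` and `k` are not adjacent, some `w` beyond `k` is adjacent to `j` and not to `i`. Either
  -- `k` is adjacent to `w` and closes a chordless four-cycle, or the induced path `k`, `i`, `j`,
  -- `w` starts `no-long-cycle`.
  simplicial : ∀ {i j k} → i Fin.< j → j Fin.< k → i ~ j → i ~ k → j ~ k
  simplicial {i} {j} {k} i<j j<k i~j i~k with b j k in jk
  ... | true  = refl
  ... | false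
    with w , k<w , i≁w , j~w , agree ← lex-step i<j i~k (false⇒≁ jk)
    with b k w in kw
  -- The edges of a four-cycle are not rigid, since two opposite edges can be exchanged for the
  -- other two. The loop at `i` with the edges at `w` is rigid and has the degrees of the loop at
  -- `w` with the edges at `i`.
  ...   | true = ⊥-elim (rigidUnique ((i , i) ∷ (j , w) ∷ (k , w) ∷ []) (w , w) ((i , j) ∷ (i , k) ∷ [])
          (b-refl i ∷ j~w ∷ kw ∷ []) (b-refl w ∷ i~j ∷ i~k ∷ [])
          (λ φ → lem (φ i) (φ j) (φ k) (φ w))
          ((((λ { (_ , i~w , _) → i≁w i~w }) , (λ { (i~w , _) → i≁w i~w }))
            ∷ ((λ { (_ , i~w , _) → i≁w i~w }) , (λ { (i~w , _) → i≁w i~w })) ∷ [])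
            ∷ (((λ { (j~k , _) → false⇒≁ jk j~k }) , (λ { (_ , _ , _ , w≢w) → w≢w refl })) ∷ [])
            ∷ [] ∷ [])
          (≢⇒not-loop i≢w ∷ ≢⇒not-loop j≢w ∷ ≢⇒not-loop k≢w ∷ []))
    where
    i≢w : i ≢ w
    i≢w = ≁⇒≢ i≁w
    j≢w : j ≢ w
    j≢w = Finₚ.<⇒≢ (Finₚ.<-trans j<k k<w)
    k≢w : k ≢ w
    k≢w = Finₚ.<⇒≢ k<w
    ≢⇒not-loop : ∀ {s t} → s ≢ w → ¬ SamePair (w , w) (s , t)
    ≢⇒not-loop s≢w (inj₁ (refl , _)) = s≢w refl
    ≢⇒not-loop s≢w (inj₂ (_ , refl)) = s≢w refl
    lem : ∀ i j k w → i + i + (j + w + (k + w + 0)) ≡ w + w + (i + j + (i + k + 0))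
    lem = solve-∀
  ...   | false = ⊥-elim (no-long-cycle (j ∷ i ∷ []) ((j , w) ∷ (i , k) ∷ (i , j) ∷ [])
          (>-wellFounded w) j<k k<w j~w (false⇒≁ kw)
          (λ { (here refl) d _ → refl ; (there (here refl)) d w<d → agree d w<d })
          ( pathEdge j~w j≢w (here refl) (inj₂ (inj₂ refl)) (λ _ → j≁k ∘ ~-sym) (λ w≡k → ⊥-elim (k≢w (sym w≡k)))
          ∷ pathEdge i~k i≢k (there (here refl)) (inj₂ (inj₁ refl)) (λ k≡w → ⊥-elim (k≢w k≡w)) (λ _ → i≁w ∘ ~-sym)
          ∷ pathEdge i~j i≢j (there (here refl)) (inj₁ (here refl)) (λ j≡w → ⊥-elim (j≢w j≡w)) (λ j≡k → ⊥-elim (j≢k j≡k))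
          ∷ [])
          ((((λ { (_ , w~k , _) → false⇒≁ kw (~-sym w~k) }) , (λ { (_ , w~i , _) → i≁w (~-sym w~i) }))
            ∷ ((λ { (_ , _ , j≢j , _) → j≢j refl }) , (λ { (_ , w~i , _) → i≁w (~-sym w~i) })) ∷ [])
            ∷ (((λ { (_ , k~j , _) → j≁k (~-sym k~j) }) , (λ { (_ , _ , i≢i , _) → i≢i refl })) ∷ [])
            ∷ [] ∷ [])
          (λ φ → lem (φ i) (φ j) (φ k) (φ w)))
    where
    j≁k : ¬ j ~ k
    j≁k = false⇒≁ jk
    i≢j : i ≢ j
    i≢j = Finₚ.<⇒≢ i<j
    j≢k : j ≢ k
    j≢k = Finₚ.<⇒≢ j<k
    i≢k : i ≢ k
    i≢k = Finₚ.<⇒≢ (Finₚ.<-trans i<j j<k)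
    j≢w : j ≢ w
    j≢w = Finₚ.<⇒≢ (Finₚ.<-trans j<k k<w)
    k≢w : k ≢ w
    k≢w = Finₚ.<⇒≢ k<w
    lem : ∀ i j k w → j + w + (i + k + (i + j + 0)) ≡ j + j + (i + i + 0) + (k + w)
    lem = solve-∀

  later-clique : ∀ {i j k} → i Fin.< j → i Fin.< k → i ~ j → i ~ k → j ~ k
  later-clique {i} {j} {k} i<j i<k i~j i~k with Finₚ.<-cmp j k
  ... | tri< j<k _ _ = simplicial i<j j<k i~j i~k
  ... | tri≈ _ refl _ = b-refl j
  ... | tri> _ _ k<j = ~-sym (simplicial i<k k<j i~k i~j)

  -- The growing sun: R consists of independent vertices, C of a clique, and r, c are the
  -- ends of the path.  M₁ matches everything, M₂ everything but r and c; after a step the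
  -- two matchings change roles.
  record SunState (p q r c : V) : Set where
    field
      R C   : List V
      M₁ M₂ : List (Pair n)
      p<r   : p Fin.< r
      q<c   : q Fin.< c
      r<q   : r Fin.< q
      p~c   : p ~ c
      r~q   : r ~ q
      r≁c   : ¬ r ~ c
      q∈C   : q ∈ C
      rows  : ∀ {t} → t ∈ R → ∀ d → c Fin.< d → b t d ≡ b p d
      cols  : ∀ {t} → t ∈ C → ∀ d → r Fin.< d → b t d ≡ b q d
      C~q   : ∀ {t} → t ∈ C → t ~ q
      C~c   : ∀ {t} → t ∈ C → t ~ c
      R<r   : ∀ {t} → t ∈ R → t Fin.< r
      R≁r   : ∀ {t} → t ∈ R → ¬ r ~ t
      -- A later neighbour in `C` keeps a vertex of `r ∷ R` from being adjacent to the next `r′`: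
      -- otherwise `later-clique` would join `r′` to `C`.
      R-nbr : ∀ {t} → t ∈ r ∷ R → ∃ λ s → s ∈ C × t ~ s × t Fin.< s
      in-M₁ : All (λ e → Joined e × proj₁ e ∈ r ∷ R × proj₂ e ∈ c ∷ C) M₁
      in-M₂ : All (λ e → Joined e × proj₁ e ∈ R × proj₂ e ∈ C) M₂
      rigid₁ : AllPairs Rigid₂ M₁
      rigid₂ : AllPairs Rigid₂ M₂
      total-M : ∀ φ → total φ M₁ ≡ total φ M₂ + (φ r + φ c)

  -- Maximal differences of the rows of `p`, `r` and of `q`, `c` give `c′`, adjacent to `r` but to
  -- nothing in `R`, and `r′`, adjacent to `c` but to nothing in `C`. If `r′` and `c′` are adjacent,
  -- the rigid matching `M₁′` has the degrees of `M₁` enlarged by the edge `{r′ , c′}`, which `M₁′`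
  -- does not contain; otherwise the sun grows.
  no-sun : ∀ {p q r c} → Acc Fin._>_ c → SunState p q r c → ⊥
  no-sun {p} {q} {r} {c} (acc rs) state
    with c′ , c<c′ , p≁c′ , r~c′ , agree-c ← lex-step (SunState.p<r state) (SunState.p~c state) (SunState.r≁c state)
    with r′ , r<r′ , q≁r′ , c~r′ , agree-r ← lex-step (SunState.q<c state) (~-sym (SunState.r~q state)) (SunState.r≁c state ∘ ~-sym)
    = finish
    where
    open SunState state
    q~c : q ~ c
    q~c = C~c q∈C
    q<c′ : q Fin.< c′
    q<c′ = Finₚ.<-trans q<c c<c′
    q~c′ : q ~ c′
    q~c′ = later-clique r<q (Finₚ.<-trans r<q q<c′) r~q r~c′
    C~c′ : ∀ {t} → t ∈ C → t ~ c′
    C~c′ t∈C = trans (cols t∈C c′ (Finₚ.<-trans r<q q<c′)) q~c′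
    c~c′ : c ~ c′
    c~c′ = later-clique q<c q<c′ q~c q~c′
    C≁r′ : ∀ {t} → t ∈ C → ¬ t ~ r′
    C≁r′ t∈C t~r′ = q≁r′ (trans (sym (cols t∈C r′ r<r′)) t~r′)
    R≁c′ : ∀ {t} → t ∈ R → ¬ t ~ c′
    R≁c′ t∈R t~c′ = p≁c′ (trans (sym (rows t∈R c′ c<c′)) t~c′)
    R′<r′ : ∀ {t} → t ∈ r ∷ R → t Fin.< r′
    R′<r′ (here refl) = r<r′
    R′<r′ (there t∈R) = Finₚ.<-trans (R<r t∈R) r<r′
    R′≁r′ : ∀ {t} → t ∈ r ∷ R → ¬ r′ ~ t
    R′≁r′ t∈R′ r′~t with s , s∈C , t~s , t<s ← R-nbr t∈R′ =
      C≁r′ s∈C (later-clique t<s (R′<r′ t∈R′) t~s (~-sym r′~t))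
    M₁′ = (r , c′) ∷ (r′ , c) ∷ M₂
    in-M₁′ : All (λ e → Joined e × proj₁ e ∈ r′ ∷ r ∷ R × proj₂ e ∈ c′ ∷ c ∷ C) M₁′
    in-M₁′ = (r~c′ , there (here refl) , here refl) ∷ (~-sym c~r′ , here refl , there (here refl))
      ∷ All.map (λ { (j , s∈R , t∈C) → j , there (there s∈R) , there (there t∈C) }) in-M₂
    rigid₁′ : AllPairs Rigid₂ M₁′
    rigid₁′ =
      (((λ { (r~r′ , _) → R′≁r′ (here refl) (~-sym r~r′) }) , (λ { (r~c , _) → r≁c r~c }))
        ∷ All.map (λ { (_ , s∈R , _) → (λ { (r~s , _) → R≁r s∈R r~s }) , (λ { (_ , c′~s , _) → R≁c′ s∈R (~-sym c′~s) }) }) in-M₂)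
      ∷ All.map (λ { (_ , s∈R , t∈C) → (λ { (r′~s , _) → R′≁r′ (there s∈R) r′~s }) , (λ { (r′~t , _) → C≁r′ t∈C (~-sym r′~t) }) }) in-M₂
      ∷ rigid₂
    total-M′ : ∀ φ → total φ M₁′ ≡ total φ M₁ + (φ r′ + φ c′)
    total-M′ φ = trans (lem (φ r) (φ c′) (φ r′) (φ c) (total φ M₂)) (cong (_+ (φ r′ + φ c′)) (sym (total-M φ)))
      where
      lem : ∀ r c′ r′ c M → r + c′ + (r′ + c + M) ≡ M + (r + c) + (r′ + c′)
      lem = solve-∀
    finish : ⊥
    finish with b r′ c′ in r′c′
    ... | true = rigidUnique M₁′ (r′ , c′) M₁ (All.map proj₁ in-M₁′) (r′c′ ∷ All.map proj₁ in-M₁)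
          (λ φ → trans (total-M′ φ) (ℕₚ.+-comm (total φ M₁) _)) rigid₁′
          (new (inj₁ r′≢r) (inj₂ (inj₂ refl)) ∷ new (inj₂ c′≢c) (inj₂ (inj₁ refl))
            ∷ All.map (λ { (_ , s∈R , t∈C) → new (inj₁ (λ { refl → Finₚ.<-irrefl refl (R′<r′ (there s∈R)) })) (inj₁ t∈C) }) in-M₂)
      where
      r′≢r : r′ ≢ r
      r′≢r = Finₚ.<⇒≢ r<r′ ∘ sym
      c′≢c : c′ ≢ c
      c′≢c = Finₚ.<⇒≢ c<c′ ∘ sym
      not-r′ : ∀ {t} → t ∈ C ⊎ t ≡ c ⊎ t ≡ c′ → r′ ≢ t
      not-r′ (inj₁ t∈C)         refl = q≁r′ (~-sym (C~q t∈C))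
      not-r′ (inj₂ (inj₁ refl)) refl = q≁r′ q~c
      not-r′ (inj₂ (inj₂ refl)) refl = q≁r′ q~c′
      new : ∀ {s t} → (r′ ≢ s) ⊎ (c′ ≢ t) → t ∈ C ⊎ t ≡ c ⊎ t ≡ c′ → ¬ SamePair (r′ , c′) (s , t)
      new (inj₁ r′≢s) _ (inj₁ (r′≡s , _)) = r′≢s r′≡s
      new (inj₂ c′≢t) _ (inj₁ (_ , c′≡t)) = c′≢t c′≡t
      new _ t∈ (inj₂ (r′≡t , _)) = not-r′ t∈ r′≡t
    ... | false = no-sun (rs c<c′) record
          { R = r ∷ R ; C = c ∷ C ; M₁ = M₁′ ; M₂ = M₁
          ; p<r = r<r′ ; q<c = c<c′ ; r<q = r′<c ; p~c = r~c′ ; r~q = ~-sym c~r′ ; r≁c = false⇒≁ r′c′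
          ; q∈C = here refl
          ; rows = λ { (here refl) d _ → refl ; (there t∈R) d c′<d → trans (rows t∈R d (Finₚ.<-trans c<c′ c′<d)) (agree-c d c′<d) }
          ; cols = λ { (here refl) d _ → refl ; (there t∈C) d r′<d → trans (cols t∈C d (Finₚ.<-trans r<r′ r′<d)) (agree-r d r′<d) }
          ; C~q = λ { (here refl) → b-refl c ; (there t∈C) → C~c t∈C }
          ; C~c = λ { (here refl) → c~c′ ; (there t∈C) → C~c′ t∈C }
          ; R<r = R′<r′ ; R≁r = R′≁r′
          ; R-nbr = λ { (here refl) → c , here refl , ~-sym c~r′ , r′<c
                      ; (there t∈R′) → let s , s∈C , t~s , t<s = R-nbr t∈R′ in s , there s∈C , t~s , t<s }
          ; in-M₁ = in-M₁′ ; in-M₂ = in-M₁ ; rigid₁ = rigid₁′ ; rigid₂ = rigid₁ ; total-M = total-M′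
          }
      where
      -- If `r′` came after `c`, it and `c′` would be later neighbours of `c` and therefore
      -- adjacent.
      r′<c : r′ Fin.< c
      r′<c with Finₚ.<-cmp r′ c
      ... | tri< lt _ _ = lt
      ... | tri≈ _ refl _ = contradiction q~c q≁r′
      ... | tri> _ _ c<r′ = contradiction (later-clique c<r′ c<c′ c~r′ c~c′) (false⇒≁ r′c′)

  -- A violation is the smallest state of a sun: `i` and `k` form `R` and `C`, and the nonadjacent
  -- `j` and `l` are the ends.
  strong : ∀ {i j k l} → i Fin.< j → j Fin.< k → k Fin.< l → i ~ k → i ~ l → j ~ k → j ~ l
  strong {i} {j} {k} {l} i<j j<k k<l i~k i~l j~k with b j l in jl
  ... | true  = refl
  ... | false = ⊥-elim (no-sun (>-wellFounded l) record
    { R = i ∷ [] ; C = k ∷ [] ; M₁ = (i , l) ∷ (j , k) ∷ [] ; M₂ = (i , k) ∷ []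
    ; p<r = i<j ; q<c = k<l ; r<q = j<k ; p~c = i~l ; r~q = j~k ; r≁c = false⇒≁ jl
    ; q∈C = here refl
    ; rows = λ { (here refl) d _ → refl }
    ; cols = λ { (here refl) d _ → refl }
    ; C~q = λ { (here refl) → b-refl k }
    ; C~c = λ { (here refl) → later-clique i<k i<l i~k i~l }
    ; R<r = λ { (here refl) → i<j }
    ; R≁r = λ { (here refl) → j≁i }
    ; R-nbr = λ { (here refl) → k , here refl , j~k , j<k ; (there (here refl)) → k , here refl , i~k , i<k }
    ; in-M₁ = (i~l , there (here refl) , here refl) ∷ (j~k , here refl , there (here refl)) ∷ []
    ; in-M₂ = (i~k , here refl , here refl) ∷ []
    ; rigid₁ = (((λ { (i~j , _) → j≁i (~-sym i~j) }) , (λ { (_ , l~j , _) → false⇒≁ jl (~-sym l~j) })) ∷ []) ∷ [] ∷ []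
    ; rigid₂ = [] ∷ []
    ; total-M = λ φ → lem (φ i) (φ j) (φ k) (φ l)
    })
    where
    i<k : i Fin.< k
    i<k = Finₚ.<-trans i<j j<k
    i<l : i Fin.< l
    i<l = Finₚ.<-trans i<k k<l
    j≁i : ¬ j ~ i
    j≁i j~i = false⇒≁ jl (later-clique i<j i<l (~-sym j~i) i~l)
    lem : ∀ i j k l → i + l + (j + k + 0) ≡ i + k + 0 + (j + l)
    lem = solve-∀

-- Edges and loops as variables

SamePair-swapʳ : ∀ {n} {e : Pair n} {s t} → SamePair e (s , t) → SamePair e (t , s)
SamePair-swapʳ = Sum.swap

SamePair-swapˡ : ∀ {n} {x y} {f : Pair n} → SamePair (x , y) f → SamePair (y , x) f
SamePair-swapˡ (inj₁ (p , q)) = inj₂ (q , p)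
SamePair-swapˡ (inj₂ (p , q)) = inj₁ (q , p)

SamePair-sym : ∀ {n} {e f : Pair n} → SamePair e f → SamePair f e
SamePair-sym (inj₁ (refl , refl)) = inj₁ (refl , refl)
SamePair-sym (inj₂ (refl , refl)) = inj₂ (refl , refl)

SamePair-trans : ∀ {n} {e f g : Pair n} → SamePair e f → SamePair f g → SamePair e g
SamePair-trans (inj₁ (refl , refl)) p = p
SamePair-trans (inj₂ (refl , refl)) p = SamePair-swapˡ p

samePair? : ∀ {n} (e f : Pair n) → Dec (SamePair e f)
samePair? (x , y) (s , t) =
  ((x Fin.≟ s) ×-dec (y Fin.≟ t)) ⊎-dec ((x Fin.≟ t) ×-dec (y Fin.≟ s))

multiplicity : ∀ {n} → List (Fin n) → Fin n → ℕ
multiplicity []       r = 0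
multiplicity (x ∷ xs) r = δ x r + multiplicity xs r

multiplicity-∈ : ∀ {n} xs {r : Fin n} → 0 < multiplicity xs r → r ∈ xs
multiplicity-∈ (x ∷ xs) {r} pos with x Fin.≟ r
... | yes refl = here refl
... | no  x≢r  = there (multiplicity-∈ xs pos)

head-∈ : ∀ {n} (x : Fin n) xs ys → (∀ r → multiplicity (x ∷ xs) r ≡ multiplicity ys r) → x ∈ ys
head-∈ x xs ys eq = multiplicity-∈ ys
  (subst (0 <_) (trans (cong (_+ multiplicity xs x) (sym (δ-refl x))) (eq x)) (s≤s z≤n))

multiplicity-pair : ∀ {n} {x y s t : Fin n} →
  (∀ r → multiplicity (x ∷ y ∷ []) r ≡ multiplicity (s ∷ t ∷ []) r) → SamePair (x , y) (s , t)
multiplicity-pair {x = x} {y} {s} {t} eq with head-∈ x (y ∷ []) (s ∷ t ∷ []) eq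
... | here refl with head-∈ y [] (t ∷ []) (λ r → ℕₚ.+-cancelˡ-≡ (δ x r) _ _ (eq r))
...   | here refl = inj₁ (refl , refl)
multiplicity-pair {x = x} {y} {s} {t} eq | there (here refl)
  with head-∈ y [] (s ∷ []) (λ r → ℕₚ.+-cancelˡ-≡ (δ x r) _ _ (trans (eq r) (lem (δ s r) (δ t r))))
  where
  lem : ∀ a b → a + (b + 0) ≡ b + (a + 0)
  lem = solve-∀
... | here refl = inj₂ (refl , refl)

module Regrouping {n : ℕ} (b : Fin n → Fin n → Bool) (b-sym : ∀ i j → b i j ≡ b j i) where
  open Matching b

  private
    V = Fin n

  SameTwoPairs : Pair n → Pair n → Pair n → Pair n → Set
  SameTwoPairs e f e′ f′ = (SamePair e e′ × SamePair f f′) ⊎ (SamePair e f′ × SamePair f e′)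

  module _ {x y s t : V} (rigid : Rigid₂ (x , y) (s , t)) where

    -- The cases follow the second end `c₂` of the pair containing `x`. If it is `s` or `t`, the
    -- regrouping is a genuine exchange excluded by `Rigid₂`, unless coinciding ends make it return
    -- the original pairs.
    regroup-head : ∀ {c₂ d₁ d₂} → x ~ c₂ → d₁ ~ d₂ →
      (∀ r → multiplicity (c₂ ∷ d₁ ∷ d₂ ∷ []) r ≡ multiplicity (y ∷ s ∷ t ∷ []) r) →
      SameTwoPairs (x , y) (s , t) (x , c₂) (d₁ , d₂)
    regroup-head {c₂} {d₁} {d₂} x~c₂ d₁~d₂ eq with head-∈ c₂ (d₁ ∷ d₂ ∷ []) (y ∷ s ∷ t ∷ []) eq
    ... | here refl = inj₁ (inj₁ (refl , refl) ,
          SamePair-sym (multiplicity-pair λ r → ℕₚ.+-cancelˡ-≡ (δ y r) _ _ (eq r)))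
    ... | there (here refl) = use (multiplicity-pair λ r → ℕₚ.+-cancelˡ-≡ (δ s r) _ _
            (trans (eq r) (lem (δ y r) (δ s r) (δ t r))))
      where
      lem : ∀ y s t → y + (s + (t + 0)) ≡ s + (y + (t + 0))
      lem = solve-∀
      joined : SamePair (d₁ , d₂) (y , t) → y ~ t
      joined (inj₁ (refl , refl)) = d₁~d₂
      joined (inj₂ (refl , refl)) = trans (b-sym y t) d₁~d₂
      use : SamePair (d₁ , d₂) (y , t) → SameTwoPairs (x , y) (s , t) (x , s) (d₁ , d₂)
      use d≡ with x Fin.≟ t | y Fin.≟ s
      ... | yes refl | _        = inj₂ (SamePair-sym (SamePair-swapʳ d≡) , inj₂ (refl , refl))
      ... | no _     | yes refl = inj₁ (inj₁ (refl , refl) , SamePair-sym d≡)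
      ... | no x≢t   | no y≢s   = ⊥-elim (proj₁ rigid (x~c₂ , joined d≡ , x≢t , y≢s))
    ... | there (there (here refl)) = use (multiplicity-pair λ r → ℕₚ.+-cancelˡ-≡ (δ t r) _ _
            (trans (eq r) (lem (δ y r) (δ s r) (δ t r))))
      where
      lem : ∀ y s t → y + (s + (t + 0)) ≡ t + (y + (s + 0))
      lem = solve-∀
      joined : SamePair (d₁ , d₂) (y , s) → y ~ s
      joined (inj₁ (refl , refl)) = d₁~d₂
      joined (inj₂ (refl , refl)) = trans (b-sym y s) d₁~d₂
      use : SamePair (d₁ , d₂) (y , s) → SameTwoPairs (x , y) (s , t) (x , t) (d₁ , d₂)
      use d≡ with x Fin.≟ s | y Fin.≟ t
      ... | yes refl | _        = inj₂ (SamePair-sym (SamePair-swapʳ d≡) , inj₁ (refl , refl))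
      ... | no _     | yes refl = inj₁ (inj₁ (refl , refl) , SamePair-sym (SamePair-swapʳ d≡))
      ... | no x≢s   | no y≢t   = ⊥-elim (proj₂ rigid (x~c₂ , joined d≡ , x≢s , y≢t))

    -- Reversing or swapping the pairs brings `x` to the front, where `regroup-head` applies.
    regroup : ∀ {c₁ c₂ d₁ d₂} → c₁ ~ c₂ → d₁ ~ d₂ →
      (∀ r → multiplicity (x ∷ y ∷ s ∷ t ∷ []) r ≡ multiplicity (c₁ ∷ c₂ ∷ d₁ ∷ d₂ ∷ []) r) →
      SameTwoPairs (x , y) (s , t) (c₁ , c₂) (d₁ , d₂)
    regroup {c₁} {c₂} {d₁} {d₂} c₁~c₂ d₁~d₂ eq with head-∈ x (y ∷ s ∷ t ∷ []) (c₁ ∷ c₂ ∷ d₁ ∷ d₂ ∷ []) eq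
    ... | here refl = regroup-head c₁~c₂ d₁~d₂ λ r → ℕₚ.+-cancelˡ-≡ (δ x r) _ _ (sym (eq r))
    ... | there (here refl) = Sum.map (λ { (p , q) → SamePair-swapʳ p , q }) (λ { (p , q) → p , SamePair-swapʳ q })
          (regroup-head (trans (b-sym c₂ c₁) c₁~c₂) d₁~d₂ λ r → ℕₚ.+-cancelˡ-≡ (δ x r) _ _
            (trans (lem (δ c₁ r) (δ c₂ r) (δ d₁ r) (δ d₂ r)) (sym (eq r))))
      where
      lem : ∀ c₁ c₂ d₁ d₂ → c₂ + (c₁ + (d₁ + (d₂ + 0))) ≡ c₁ + (c₂ + (d₁ + (d₂ + 0)))
      lem = solve-∀
    ... | there (there (here refl)) = Sum.swap
          (regroup-head d₁~d₂ c₁~c₂ λ r → ℕₚ.+-cancelˡ-≡ (δ x r) _ _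
            (trans (lem (δ c₁ r) (δ c₂ r) (δ d₁ r) (δ d₂ r)) (sym (eq r))))
      where
      lem : ∀ c₁ c₂ d₁ d₂ → d₁ + (d₂ + (c₁ + (c₂ + 0))) ≡ c₁ + (c₂ + (d₁ + (d₂ + 0)))
      lem = solve-∀
    ... | there (there (there (here refl))) = Sum.map (λ { (p , q) → p , SamePair-swapʳ q }) (λ { (p , q) → SamePair-swapʳ p , q })
          (Sum.swap (regroup-head (trans (b-sym d₂ d₁) d₁~d₂) c₁~c₂ λ r → ℕₚ.+-cancelˡ-≡ (δ x r) _ _
            (trans (lem (δ c₁ r) (δ c₂ r) (δ d₁ r) (δ d₂ r)) (sym (eq r)))))
      where
      lem : ∀ c₁ c₂ d₁ d₂ → d₂ + (d₁ + (c₁ + (c₂ + 0))) ≡ c₁ + (c₂ + (d₁ + (d₂ + 0)))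
      lem = solve-∀

lookup-injective : ∀ {a} {A : Set a} {xs : List A} → Unique xs →
  ∀ i j → List.lookup xs i ≡ List.lookup xs j → i ≡ j
lookup-injective (_ ∷ _)   zero    zero    _  = refl
lookup-injective (x≢ ∷ _)  zero    (suc j) eq = contradiction eq (All.lookup x≢ (∈-lookup j))
lookup-injective (x≢ ∷ _)  (suc i) zero    eq = contradiction (sym eq) (All.lookup x≢ (∈-lookup i))
lookup-injective (_ ∷ uniq) (suc i) (suc j) eq = cong suc (lookup-injective uniq i j eq)

sumVars : ∀ {N} → List (Fin N) → Monomial N
sumVars []       = 𝟘
sumVars (c ∷ cs) = var c ⊕ sumVars cs

lookup-sumVars : ∀ {N} (cs : List (Fin N)) i → lookup (sumVars cs) i ≡ multiplicity cs i
lookup-sumVars []       i = Vecₚ.lookup-replicate i 0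
lookup-sumVars (c ∷ cs) i = trans (lookup-⊕ (var c) (sumVars cs) i) (cong₂ _+_ (lookup-var c i) (lookup-sumVars cs i))

-- The hypothesis says that the product of the variables `a` and `b` divides that of `cs`. Counted
-- with multiplicity they occupy two different positions of `cs`, even if they are equal, and
-- positions are what `AllPairs` relates.
pairs-of : ∀ {N r} {R : Fin N → Fin N → Set r} → Symmetric R → ∀ {cs} → AllPairs R cs → ∀ {a b} →
  (∀ i → δ a i + δ b i ≤ multiplicity cs i) → R a b
pairs-of R-sym [] {a} {b} le with () ← subst (_≤ 0) (cong (_+ δ b a) (δ-refl a)) (le a)
pairs-of R-sym {c ∷ cs} (Rc ∷ Rcs) {a} {b} le with c Fin.≟ a | c Fin.≟ b
... | yes refl | _ = All.lookup Rc (multiplicity-∈ cs (subst (_≤ multiplicity cs b) (δ-refl b) (ℕₚ.+-cancelˡ-≤ (δ c b) _ _ (le b))))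
... | no _ | yes refl = R-sym (All.lookup Rc (multiplicity-∈ cs (subst (_≤ multiplicity cs a) (δ-refl a)
      (ℕₚ.+-cancelʳ-≤ (δ c a) _ _ (ℕₚ.≤-trans (le a) (ℕₚ.≤-reflexive (ℕₚ.+-comm (δ c a) _)))))))
... | no c≢a | no c≢b = pairs-of R-sym Rcs le′
  where
  le′ : ∀ i → δ a i + δ b i ≤ multiplicity cs i
  le′ i with c Fin.≟ i
  ... | yes refl rewrite δ-≢ (≢-sym c≢a) | δ-≢ (≢-sym c≢b) = z≤n
  ... | no c≢i = subst (λ x → δ a i + δ b i ≤ x + multiplicity cs i) (δ-≢ c≢i) (le i)

weighted : ∀ {N} → (Fin N → ℕ) → Monomial N → ℕ
weighted a u = sum (λ c → a c * lookup u c)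

weighted-𝟘 : ∀ {N} (a : Fin N → ℕ) → weighted a 𝟘 ≡ 0
weighted-𝟘 a = sum-zero λ c → trans (cong (a c *_) (Vecₚ.lookup-replicate c 0)) (ℕₚ.*-zeroʳ (a c))

weighted-⊕ : ∀ {N} (a : Fin N → ℕ) u v → weighted a (u ⊕ v) ≡ weighted a u + weighted a v
weighted-⊕ a u v = trans
  (sum-cong-≗ λ c → trans (cong (a c *_) (lookup-⊕ u v c)) (ℕₚ.*-distribˡ-+ (a c) (lookup u c) (lookup v c)))
  (∑-distrib-+ (λ c → a c * lookup u c) _)

weighted-var : ∀ {N} (a : Fin N → ℕ) c → weighted a (var c) ≡ a c
weighted-var a c = trans (sum-cong-≗ λ i → cong (a i *_) (lookup-var c i)) (sum-δ c a)

weighted-var² : ∀ {N} (a : Fin N → ℕ) c d → weighted a (var c ⊕ var d) ≡ a c + a d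
weighted-var² a c d = trans (weighted-⊕ a (var c) (var d)) (cong₂ _+_ (weighted-var a c) (weighted-var a d))

-- Fibers as multisets of edges and loops with given degrees

module GraphFibers {n : ℕ} (G : SimpleGraph n) where

  N : ℕ
  N = n + m G

  open Fibers (extendedIncidence G)

  _∈?_ : ∀ (e : Pair n) es → Dec (e ∈ es)
  _∈?_ = DecMembership._∈?_ (Productₚ.≡-dec Fin._≟_ Fin._≟_)

  -- Equality accounts for the loops, which are the columns of twice the identity matrix.
  Joinable : Fin n → Fin n → Set
  Joinable x y = x ≡ y ⊎ Adj G x y

  joinable? : ∀ x y → Dec (Joinable x y)
  joinable? x y = (x Fin.≟ y) ⊎-dec (((x , y) ∈? edges G) ⊎-dec ((y , x) ∈? edges G))

  b : Fin n → Fin n → Bool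
  b x y = does (joinable? x y)

  open Matching b

  ~⇒joinable : ∀ {x y} → x ~ y → Joinable x y
  ~⇒joinable {x} {y} x~y = invert (subst (Reflects (Joinable x y)) x~y (proof (joinable? x y)))

  joinable⇒~ : ∀ {x y} → Joinable x y → x ~ y
  joinable⇒~ {x} {y} p = dec-true (joinable? x y) p

  joinable-sym : ∀ {x y} → Joinable x y → Joinable y x
  joinable-sym = Sum.map sym Sum.swap

  b-refl : ∀ x → b x x ≡ true
  b-refl x = joinable⇒~ {x} {x} (inj₁ refl)

  b-sym : ∀ x y → b x y ≡ b y x
  b-sym x y = does-⇔ (mk⇔ joinable-sym joinable-sym) (joinable? x y) (joinable? y x)

  open Regrouping b b-sym

  endsOf : Fin n ⊎ Fin (m G) → Pair n
  endsOf = [ (λ i → i , i) , edge G ]′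

  ends : Fin N → Pair n
  ends c = endsOf (splitAt n c)

  ends-joined : ∀ c → Joined (ends c)
  ends-joined c with splitAt n c
  ... | inj₁ i = b-refl i
  ... | inj₂ e = joinable⇒~ (inj₂ (inj₁ (∈-lookup e)))

  samePair⇒joinable : ∀ {x y} c → SamePair (x , y) (ends c) → Joinable x y
  samePair⇒joinable c (inj₁ (refl , refl)) = ~⇒joinable (ends-joined c)
  samePair⇒joinable c (inj₂ (refl , refl)) = joinable-sym (~⇒joinable (ends-joined c))

  edge-ordered : ∀ e → proj₁ (edge G e) Fin.< proj₂ (edge G e)
  edge-ordered e = All.lookup (ordered G) (∈-lookup e)

  endsOf-injective : ∀ c d → SamePair (endsOf c) (endsOf d) → c ≡ d
  endsOf-injective (inj₁ i) (inj₁ j) (inj₁ (refl , _)) = refl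
  endsOf-injective (inj₁ i) (inj₁ j) (inj₂ (refl , _)) = refl
  endsOf-injective (inj₁ i) (inj₂ e) (inj₁ (p , q)) = contradiction (edge-ordered e) (Finₚ.<-irrefl (trans (sym p) q))
  endsOf-injective (inj₁ i) (inj₂ e) (inj₂ (p , q)) = contradiction (edge-ordered e) (Finₚ.<-irrefl (trans (sym q) p))
  endsOf-injective (inj₂ e) (inj₁ i) (inj₁ (p , q)) = contradiction (edge-ordered e) (Finₚ.<-irrefl (trans p (sym q)))
  endsOf-injective (inj₂ e) (inj₁ i) (inj₂ (p , q)) = contradiction (edge-ordered e) (Finₚ.<-irrefl (trans p (sym q)))
  endsOf-injective (inj₂ e) (inj₂ f) (inj₁ (p , q)) = cong inj₂ (lookup-injective (distinct G) e f (cong₂ _,_ p q))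
  endsOf-injective (inj₂ e) (inj₂ f) (inj₂ (p , q)) = contradiction (edge-ordered e)
    (Finₚ.<-asym (subst₂ Fin._<_ (sym q) (sym p) (edge-ordered f)))

  ends-injective : ∀ c d → SamePair (ends c) (ends d) → c ≡ d
  ends-injective c d same = trans (sym (Finₚ.join-splitAt n (m G) c))
    (trans (cong (Fin.join n (m G)) (endsOf-injective (splitAt n c) (splitAt n d) same)) (Finₚ.join-splitAt n (m G) d))

  pair-injective : ∀ {e} c d → SamePair e (ends c) → SamePair e (ends d) → c ≡ d
  pair-injective c d p q = ends-injective c d (SamePair-trans (SamePair-sym p) q)

  -- Meaningful for joinable vertices only: other pairs are sent to a loop.
  joinVar : Fin n → Fin n → Fin N
  joinVar x y with (x , y) ∈? edges G | (y , x) ∈? edges G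
  ... | yes p | _     = n ↑ʳ index p
  ... | no _  | yes p = n ↑ʳ index p
  ... | no _  | no _  = x ↑ˡ m G

  ends-↑ʳ : ∀ {e} (p : e ∈ edges G) → ends (n ↑ʳ index p) ≡ e
  ends-↑ʳ p = trans (cong endsOf (Finₚ.splitAt-↑ʳ n (m G) (index p))) (sym (lookup-index p))

  ends-variable : ∀ {x y} → Joinable x y → SamePair (x , y) (ends (joinVar x y))
  ends-variable {x} {y} j with (x , y) ∈? edges G | (y , x) ∈? edges G
  ... | yes p | _     = subst (SamePair (x , y)) (sym (ends-↑ʳ p)) (inj₁ (refl , refl))
  ... | no _  | yes p = subst (SamePair (x , y)) (sym (ends-↑ʳ p)) (inj₂ (refl , refl))
  ... | no ¬p | no ¬q with j
  ...   | inj₁ refl     = subst (SamePair (x , x)) (cong endsOf (sym (Finₚ.splitAt-↑ˡ n x (m G)))) (inj₁ (refl , refl))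
  ...   | inj₂ (inj₁ p) = contradiction p ¬p
  ...   | inj₂ (inj₂ q) = contradiction q ¬q

  -- A loop counts twice at its vertex, as its column requires.
  incidences : Fin N → Fin n → ℕ
  incidences c r = δ (proj₁ (ends c)) r + δ (proj₂ (ends c)) r

  samePair-incidences : ∀ {x y} c → SamePair (x , y) (ends c) → ∀ r → incidences c r ≡ δ x r + δ y r
  samePair-incidences c (inj₁ (refl , refl)) r = refl
  samePair-incidences c (inj₂ (refl , refl)) r = ℕₚ.+-comm (δ (proj₁ (ends c)) r) _

  incident⇒end : ∀ c x → 0 < incidences c x → ∃ λ y → SamePair (x , y) (ends c)
  incident⇒end c x pos with proj₁ (ends c) Fin.≟ x | proj₂ (ends c) Fin.≟ x
  ... | yes p | _     = _ , inj₁ (sym p , refl)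
  ... | no _  | yes p = _ , inj₂ (sym p , refl)

  degree : Monomial N → Fin n → ℕ
  degree u r = weighted (λ c → incidences c r) u

  unit≡δ : ∀ {k} (i r : Fin k) → unit i r ≡ +ℤ δ i r
  unit≡δ i r with i Fin.≟ r
  ... | yes _ = refl
  ... | no _  = refl

  extendedIncidence≡ : ∀ c r → extendedIncidence G c r ≡ +ℤ incidences c r
  extendedIncidence≡ c r with splitAt n c
  ... | inj₁ i = trans (cong (+ℤ 2 ℤ.*_) (unit≡δ i r)) (trans (sym (ℤₚ.pos-* 2 (δ i r)))
                   (cong (λ x → +ℤ (δ i r + x)) (ℕₚ.+-identityʳ (δ i r))))
  ... | inj₂ e = cong₂ ℤ._+_ (unit≡δ (proj₁ (edge G e)) r) (unit≡δ (proj₂ (edge G e)) r)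

  ∑≡sum : ∀ {k} (f : Fin k → ℤ) (g : Fin k → ℕ) → (∀ i → f i ≡ +ℤ g i) → ∑ f ≡ +ℤ sum g
  ∑≡sum {zero}  f g eq = refl
  ∑≡sum {suc k} f g eq = cong₂ ℤ._+_ (eq zero) (∑≡sum (f ∘ suc) (g ∘ suc) (eq ∘ suc))

  image≡degree : ∀ u r → image u r ≡ +ℤ degree u r
  image≡degree u r = ∑≡sum _ _ λ c → trans (cong (ℤ._* +ℤ lookup u c) (extendedIncidence≡ c r))
    (sym (ℤₚ.pos-* (incidences c r) (lookup u c)))

  sameFiber⇒degree : ∀ {u v} → SameFiber u v → ∀ r → degree u r ≡ degree v r
  sameFiber⇒degree {u} {v} u~v r = ℤₚ.+-injective (trans (sym (image≡degree u r)) (trans (u~v r) (image≡degree v r)))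

  degree⇒sameFiber : ∀ {u v} → (∀ r → degree u r ≡ degree v r) → SameFiber u v
  degree⇒sameFiber {u} {v} eq r = trans (image≡degree u r) (trans (cong +ℤ_ (eq r)) (sym (image≡degree v r)))

  degree-var² : ∀ c d r → degree (var c ⊕ var d) r ≡ incidences c r + incidences d r
  degree-var² c d r = weighted-var² (λ c → incidences c r) c d

  variables : List (Pair n) → List (Fin N)
  variables = List.map (uncurry joinVar)

  degree-variables : ∀ {es} → All Joined es → ∀ r → degree (sumVars (variables es)) r ≡ total (λ x → δ x r) es
  degree-variables [] r = weighted-𝟘 (λ c → incidences c r)
  degree-variables {(x , y) ∷ es} (j ∷ js) r = trans (weighted-⊕ (λ c → incidences c r) (var (joinVar x y)) _)
    (cong₂ _+_ (trans (weighted-var (λ c → incidences c r) (joinVar x y)) (samePair-incidences (joinVar x y) (ends-variable (~⇒joinable j)) r))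
               (degree-variables js r))

  RigidVars : Fin N → Fin N → Set
  RigidVars a b = ∀ c d → SameFiber (var a ⊕ var b) (var c ⊕ var d) → var a ⊕ var b ≡ var c ⊕ var d

  rigidVars-sym : Symmetric RigidVars
  rigidVars-sym {a} {b} rigid c d same = trans (⊕-comm (var b) (var a))
    (rigid c d (subst (λ u → SameFiber u (var c ⊕ var d)) (⊕-comm (var b) (var a)) same))

  -- Equality of degrees is equality of the four ends with multiplicity, so `regroup` applies, and a
  -- pair of ends determines its variable.
  rigid₂⇒rigidVars : ∀ {x y s t} → x ~ y → s ~ t → Rigid₂ (x , y) (s , t) → RigidVars (joinVar x y) (joinVar s t)
  rigid₂⇒rigidVars {x} {y} {s} {t} x~y s~t rigid c d same
    with regroup rigid (ends-joined c) (ends-joined d) degrees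
    where
    xy = ends-variable (~⇒joinable x~y)
    st = ends-variable (~⇒joinable s~t)
    lem : ∀ a b c d → a + (b + (c + (d + 0))) ≡ (a + b) + (c + d)
    lem = solve-∀
    degrees : ∀ r → multiplicity (x ∷ y ∷ s ∷ t ∷ []) r ≡
      multiplicity (proj₁ (ends c) ∷ proj₂ (ends c) ∷ proj₁ (ends d) ∷ proj₂ (ends d) ∷ []) r
    degrees r = begin
      multiplicity (x ∷ y ∷ s ∷ t ∷ []) r         ≡⟨ lem (δ x r) (δ y r) (δ s r) (δ t r) ⟩
      (δ x r + δ y r) + (δ s r + δ t r)           ≡⟨ cong₂ _+_ (samePair-incidences (joinVar x y) xy r) (samePair-incidences (joinVar s t) st r) ⟨
      incidences (joinVar x y) r + incidences (joinVar s t) r ≡⟨ degree-var² (joinVar x y) (joinVar s t) r ⟨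
      degree (var (joinVar x y) ⊕ var (joinVar s t)) r ≡⟨ sameFiber⇒degree {var (joinVar x y) ⊕ var (joinVar s t)} {var c ⊕ var d} same r ⟩
      degree (var c ⊕ var d) r                    ≡⟨ degree-var² c d r ⟩
      incidences c r + incidences d r             ≡⟨ lem (δ (proj₁ (ends c)) r) (δ (proj₂ (ends c)) r) (δ (proj₁ (ends d)) r) (δ (proj₂ (ends d)) r) ⟨
      multiplicity (proj₁ (ends c) ∷ proj₂ (ends c) ∷ proj₁ (ends d) ∷ proj₂ (ends d) ∷ []) r ∎
      where open ≡-Reasoning
  ... | inj₁ (xy≡c , st≡d) = cong₂ (λ a b → var a ⊕ var b)
        (pair-injective (joinVar x y) c (ends-variable (~⇒joinable x~y)) xy≡c)
        (pair-injective (joinVar s t) d (ends-variable (~⇒joinable s~t)) st≡d)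
  ... | inj₂ (xy≡d , st≡c) = trans (cong₂ (λ a b → var a ⊕ var b)
        (pair-injective (joinVar x y) d (ends-variable (~⇒joinable x~y)) xy≡d)
        (pair-injective (joinVar s t) c (ends-variable (~⇒joinable s~t)) st≡c))
        (⊕-comm (var d) (var c))

  allPairs-rigidVars : ∀ {es} → All Joined es → AllPairs Rigid₂ es → AllPairs RigidVars (variables es)
  allPairs-rigidVars [] [] = []
  allPairs-rigidVars (j ∷ js) (rs ∷ rss) =
    Allₚ.map⁺ (All.zipWith (λ { (j′ , r) → rigid₂⇒rigidVars j j′ r }) (js , rs)) ∷ allPairs-rigidVars js rss

  -- The two factors touched by a move occupy different positions, so their rigidity makes the move
  -- trivial; a path starting at the product never leaves it.
  rigid⇒isolated : ∀ {cs} → AllPairs RigidVars cs → ∀ {u v} → sumVars cs ≡ u → Connected u v → sumVars cs ≡ v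
  rigid⇒isolated rigid u≡ ε = u≡
  rigid⇒isolated {cs} rigid u≡ ((p , q , γ , dp , dq , p~q , refl , refl) ◅ rest)
    with a , b , refl ← deg≡2⇒var² p dp | c , d , refl ← deg≡2⇒var² q dq =
    rigid⇒isolated rigid (trans u≡ (cong (γ ⊕_) (pairs-of rigidVars-sym rigid le c d p~q))) rest
    where
    le : ∀ i → δ a i + δ b i ≤ multiplicity cs i
    le i = begin
      δ a i + δ b i                        ≡⟨ cong₂ _+_ (lookup-var a i) (lookup-var b i) ⟨
      lookup (var a) i + lookup (var b) i  ≡⟨ lookup-⊕ (var a) (var b) i ⟨
      lookup (var a ⊕ var b) i             ≤⟨ ℕₚ.m≤n+m _ (lookup γ i) ⟩
      lookup γ i + lookup (var a ⊕ var b) i ≡⟨ lookup-⊕ γ (var a ⊕ var b) i ⟨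
      lookup (γ ⊕ (var a ⊕ var b)) i       ≡⟨ cong (λ u → lookup u i) u≡ ⟨
      lookup (sumVars cs) i                ≡⟨ lookup-sumVars cs i ⟩
      multiplicity cs i                    ∎
      where open ℕₚ.≤-Reasoning

  -- Both multisets give monomials of one fiber. By rigidity the first is connected only to itself,
  -- so the two are equal, and the variable of `f` occurs among those of `es`, which `new` forbids.
  connected⇒rigidUnique : FibersConnected → RigidUnique
  connected⇒rigidUnique conn es f@(x , y) fs js (j ∷ js′) eq rigid new =
    let (s , t) , e∈es , f≡e = ∈-map⁻ (uncurry joinVar) f∈es in All.lookup new e∈es
      (SamePair-trans (ends-variable (~⇒joinable j)) (subst (λ c → SamePair (ends c) (s , t)) (sym f≡e)
        (SamePair-sym (ends-variable (~⇒joinable (All.lookup js e∈es))))))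
    where
    same : sumVars (variables es) ≡ sumVars (variables (f ∷ fs))
    same = rigid⇒isolated (allPairs-rigidVars js rigid) refl (conn _ _ (degree⇒sameFiber
      {sumVars (variables es)} {sumVars (variables (f ∷ fs))}
      λ r → trans (degree-variables js r) (trans (eq (λ z → δ z r)) (sym (degree-variables (j ∷ js′) r)))))
    f∈es : joinVar x y ∈ variables es
    f∈es = head-∈ (joinVar x y) (variables fs) (variables es) λ i → begin
      multiplicity (variables (f ∷ fs)) i       ≡⟨ lookup-sumVars (variables (f ∷ fs)) i ⟨
      lookup (sumVars (variables (f ∷ fs))) i   ≡⟨ cong (λ u → lookup u i) same ⟨
      lookup (sumVars (variables es)) i         ≡⟨ lookup-sumVars (variables es) i ⟩
      multiplicity (variables es) i             ∎
      where open ≡-Reasoning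

-- The fibers speak of vertices, whereas the elimination argument works with positions in an
-- ordering.
rigidUnique-relabel : ∀ {n} (b : Fin n → Fin n → Bool) (σ : Fin n → Fin n) → (∀ {x y} → σ x ≡ σ y → x ≡ y) →
  Matching.RigidUnique b → Matching.RigidUnique (λ i j → b (σ i) (σ j))
rigidUnique-relabel {n} b σ σ-injective unique es f fs js js′ eq rigid new =
  unique (List.map σ² es) (σ² f) (List.map σ² fs) (Allₚ.map⁺ js) (Allₚ.map⁺ js′)
    (λ φ → trans (total-map φ es) (trans (eq (φ ∘ σ)) (sym (total-map φ (f ∷ fs)))))
    (AllPairsₚ.map⁺ (AllPairs.map (λ { (r₁ , r₂) →
      (λ { (p , q , x≢ , y≢) → r₁ (p , q , x≢ ∘ cong σ , y≢ ∘ cong σ) }) ,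
      (λ { (p , q , x≢ , y≢) → r₂ (p , q , x≢ ∘ cong σ , y≢ ∘ cong σ) }) }) rigid))
    (Allₚ.map⁺ (All.map (λ ¬same → ¬same ∘ Sum.map (λ { (p , q) → σ-injective p , σ-injective q })
      (λ { (p , q) → σ-injective p , σ-injective q })) new))
  where
  σ² : Pair n → Pair n
  σ² (x , y) = σ x , σ y
  total-map : ∀ φ es → total φ (List.map σ² es) ≡ total (φ ∘ σ) es
  total-map φ []             = refl
  total-map φ ((x , y) ∷ es) = cong (_+_ (φ (σ x) + φ (σ y))) (total-map φ es)

connected⇒stronglyChordal : ∀ {n} (G : SimpleGraph n) →
  Fibers.FibersConnected (extendedIncidence G) → StronglyChordal G
connected⇒stronglyChordal {n} G conn with σ , sorted ← DoublyLexical.lexSorted-exists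
    (GraphFibers.b G) (GraphFibers.b-refl G) (GraphFibers.b-sym G) =
  σ , (λ i j k i<j i<k j≢k ij ik → adjacent j≢k (later-clique i<j i<k (joined ij) (joined ik))) ,
      (λ i j k l i<j j<k k<l ik il jk →
        adjacent (Finₚ.<⇒≢ (Finₚ.<-trans j<k k<l)) (strong i<j j<k k<l (joined ik) (joined il) (joined jk)))
  where
  open GraphFibers G
  σ-injective : ∀ {i j} → σ ⟨$⟩ʳ i ≡ σ ⟨$⟩ʳ j → i ≡ j
  σ-injective eq = trans (sym (inverseˡ σ)) (trans (cong (σ ⟨$⟩ˡ_) eq) (inverseˡ σ))
  open GammaFree (λ i j → b (σ ⟨$⟩ʳ i) (σ ⟨$⟩ʳ j)) (λ i → b-refl (σ ⟨$⟩ʳ i)) (λ i j → b-sym (σ ⟨$⟩ʳ i) (σ ⟨$⟩ʳ j)) sorted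
    (rigidUnique-relabel b (σ ⟨$⟩ʳ_) σ-injective (connected⇒rigidUnique conn))
  joined : ∀ {i j} → Adj G (σ ⟨$⟩ʳ i) (σ ⟨$⟩ʳ j) → b (σ ⟨$⟩ʳ i) (σ ⟨$⟩ʳ j) ≡ true
  joined = joinable⇒~ ∘ inj₂
  adjacent : ∀ {i j} → i ≢ j → b (σ ⟨$⟩ʳ i) (σ ⟨$⟩ʳ j) ≡ true → Adj G (σ ⟨$⟩ʳ i) (σ ⟨$⟩ʳ j)
  adjacent i≢j ij = fromInj₂ (λ eq → contradiction (σ-injective eq) i≢j) (~⇒joinable ij)

-- The Gröbner basis of a strongly chordal graph

sum-<⇒∃< : ∀ {k} (f g : Fin k → ℕ) → sum f ≤ sum g → ∀ c → g c < f c → ∃ λ d → f d < g d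
sum-<⇒∃< f g le c g<f with Finₚ.any? (λ d → f d ℕₚ.<? g d)
... | yes found = found
... | no none = contradiction le (ℕₚ.<⇒≱ (strict f g (λ d → ℕₚ.≮⇒≥ λ lt → none (d , lt)) c g<f))
  where
  strict : ∀ {k} (f g : Fin k → ℕ) → (∀ d → g d ≤ f d) → ∀ c → g c < f c → sum g < sum f
  strict f g g≤f zero    lt = ℕₚ.+-mono-<-≤ lt (sum-mono (g≤f ∘ suc))
  strict f g g≤f (suc c) lt = ℕₚ.+-mono-≤-< (g≤f zero) (strict (f ∘ suc) (g ∘ suc) (g≤f ∘ suc) c lt)

least : ∀ {k} {P : Fin k → Set} → Decidable P → (rank : Fin k → ℕ) → ∃ P →
  ∃ λ i → P i × (∀ {j} → P j → rank i ≤ rank j)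
least {P = P} P? rank (i , Pi) = go i Pi (<-wellFounded (rank i))
  where
  go : ∀ i → P i → Acc _<_ (rank i) → ∃ λ i → P i × (∀ {j} → P j → rank i ≤ rank j)
  go i Pi (acc rs) with Finₚ.any? (λ j → P? j ×-dec (rank j ℕₚ.<? rank i))
  ... | yes (j , Pj , lt) = go j Pj (rs lt)
  ... | no none = i , Pi , λ {j} Pj → ℕₚ.≮⇒≥ λ lt → none (j , Pj , lt)

*-cancelˡ-<′ : ∀ k {x y} → k * x < k * y → x < y × 0 < k
*-cancelˡ-<′ (suc k) {x} {y} lt = ℕₚ.*-cancelˡ-< (suc k) x y lt , s≤s z≤n

-- The weights w i j = M − i j satisfy w i k + w j l − w i j − w k l = (k − j) (l − i).
rearrangement : ∀ {i j k l} → j < k → i < l → i * k + j * l < i * j + k * l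
rearrangement {i} {j} {k} {l} j<k i<l = begin-strict
  i * k + j * l                                   ≡⟨ cong₂ (λ k l → i * k + j * l) k≡ l≡ ⟩
  i * (suc j + x) + j * (suc i + y)               <⟨ ℕₚ.m<m+n _ (s≤s z≤n) ⟩
  i * (suc j + x) + j * (suc i + y) + suc x * suc y ≡⟨ lem i j x y ⟩
  i * j + (suc j + x) * (suc i + y)               ≡⟨ cong₂ (λ k l → i * j + k * l) k≡ l≡ ⟨
  i * j + k * l                                   ∎
  where
  open ℕₚ.≤-Reasoning
  x = k ∸ suc j
  y = l ∸ suc i
  k≡ : k ≡ suc j + x
  k≡ = sym (ℕₚ.m+[n∸m]≡n j<k)
  l≡ : l ≡ suc i + y
  l≡ = sym (ℕₚ.m+[n∸m]≡n i<l)
  lem : ∀ i j x y → i * (suc j + x) + j * (suc i + y) + suc x * suc y ≡ i * j + (suc j + x) * (suc i + y)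
  lem = solve-∀

complement-< : ∀ {M a b c d} → a ≤ M → b ≤ M → c ≤ M → d ≤ M → c + d < a + b →
  (M ∸ a) + (M ∸ b) < (M ∸ c) + (M ∸ d)
complement-< {M} {a} {b} {c} {d} a≤ b≤ c≤ d≤ lt = ℕₚ.+-cancelʳ-< (c + d) _ _ (begin-strict
  (M ∸ a) + (M ∸ b) + (c + d)   <⟨ ℕₚ.+-monoʳ-< ((M ∸ a) + (M ∸ b)) lt ⟩
  (M ∸ a) + (M ∸ b) + (a + b)   ≡⟨ sums a≤ b≤ ⟩
  M + M                         ≡⟨ sums c≤ d≤ ⟨
  (M ∸ c) + (M ∸ d) + (c + d)   ∎)
  where
  open ℕₚ.≤-Reasoning
  lem : ∀ x y a b → x + y + (a + b) ≡ (x + a) + (y + b)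
  lem = solve-∀
  sums : ∀ {a b} → a ≤ M → b ≤ M → (M ∸ a) + (M ∸ b) + (a + b) ≡ M + M
  sums {a} {b} a≤ b≤ = trans (lem (M ∸ a) (M ∸ b) a b) (cong₂ _+_ (ℕₚ.m∸n+n≡m a≤) (ℕₚ.m∸n+n≡m b≤))

module ChordalGroebner {c ℓ} (K : Field c ℓ) {n : ℕ} (G : SimpleGraph n) (σ : Fin n ↔ Fin n)
  (peo : IsStrongPerfectEliminationOrdering G σ) where

  open GraphFibers G
  open Fibers (extendedIncidence G)

  pos : Fin n → Fin n
  pos = σ ⟨$⟩ˡ_

  rank : Fin n → ℕ
  rank = toℕ ∘ pos

  pos-injective : ∀ {x y} → pos x ≡ pos y → x ≡ y
  pos-injective eq = trans (sym (inverseʳ σ)) (trans (cong (σ ⟨$⟩ʳ_) eq) (inverseʳ σ))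

  rank-≤∧≢⇒< : ∀ {x y} → rank x ≤ rank y → x ≢ y → rank x < rank y
  rank-≤∧≢⇒< le x≢y = ℕₚ.≤∧≢⇒< le (x≢y ∘ pos-injective ∘ Finₚ.toℕ-injective)

  rank-<⇒≢ : ∀ {x y} → rank x < rank y → x ≢ y
  rank-<⇒≢ lt refl = ℕₚ.n≮n _ lt

  adjacent : ∀ {x y} → x ≢ y → Joinable x y → Adj G (σ ⟨$⟩ʳ pos x) (σ ⟨$⟩ʳ pos y)
  adjacent x≢y j = subst₂ (Adj G) (sym (inverseʳ σ)) (sym (inverseʳ σ)) (fromInj₂ (λ eq → contradiction eq x≢y) j)

  joinable : ∀ {x y} → Adj G (σ ⟨$⟩ʳ pos x) (σ ⟨$⟩ʳ pos y) → Joinable x y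
  joinable adj = inj₂ (subst₂ (Adj G) (inverseʳ σ) (inverseʳ σ) adj)

  later-joinable : ∀ {i j k} → rank i < rank j → rank i < rank k → Joinable i j → Joinable i k → Joinable j k
  later-joinable {i} {j} {k} i<j i<k ij ik with j Fin.≟ k
  ... | yes refl = inj₁ refl
  ... | no j≢k = joinable (proj₁ peo (pos i) (pos j) (pos k) i<j i<k (j≢k ∘ pos-injective)
        (adjacent (rank-<⇒≢ i<j) ij) (adjacent (rank-<⇒≢ i<k) ik))

  -- Only for `l` strictly between `i` and `j` is the strong condition used, on `i`, `l`, `j`, `k`
  -- in this order. In the other cases `k` and `l` are later neighbours of a common vertex, `i` or
  -- `j`.
  exchange : ∀ {i j k l} → rank i ≤ rank j → rank j < rank k → rank i < rank l →
    Joinable i j → Joinable i k → Joinable j l → Joinable k l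
  exchange {i} {j} {k} {l} i≤j j<k i<l ij ik jl with i Fin.≟ j
  ... | yes refl = later-joinable j<k i<l ik jl
  ... | no i≢j with ℕₚ.<-cmp (rank l) (rank j)
  ...   | tri≈ _ l≡j _ with refl ← pos-injective (Finₚ.toℕ-injective l≡j) =
          joinable-sym (later-joinable i<l (ℕₚ.<-trans i<l j<k) ij ik)
  ...   | tri> _ _ j<l = later-joinable j<k j<l (later-joinable i<j (ℕₚ.<-trans i<j j<k) ij ik) jl
    where
    i<j = rank-≤∧≢⇒< i≤j i≢j
  ...   | tri< l<j _ _ = joinable-sym (joinable (proj₂ peo (pos i) (pos l) (pos j) (pos k) i<l l<j j<k
          (adjacent i≢j ij) (adjacent (rank-<⇒≢ (ℕₚ.≤-<-trans i≤j j<k)) ik) (adjacent (rank-<⇒≢ l<j) (joinable-sym jl))))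

  -- Positions are counted from zero, and `n * n` bounds every product of two of them, so the
  -- truncated subtraction is exact.
  weight : Fin N → ℕ
  weight c = n * n ∸ rank (proj₁ (ends c)) * rank (proj₂ (ends c))

  weight-ends : ∀ {x y} c → SamePair (x , y) (ends c) → weight c ≡ n * n ∸ rank x * rank y
  weight-ends c (inj₁ (refl , refl)) = refl
  weight-ends c (inj₂ (refl , refl)) = cong (n * n ∸_) (ℕₚ.*-comm (rank (proj₁ (ends c))) _)

  ω : Monomial N → ℕ
  ω = weighted weight

  open FunctionalOrder {N}
  open QuadraticGroebner K (extendedIncidence G) (weightOrder K ω (weighted-⊕ weight))

  rank-*-≤ : ∀ x y → rank x * rank y ≤ n * n
  rank-*-≤ x y = ℕₚ.*-mono-≤ (ℕₚ.<⇒≤ (Finₚ.toℕ<n (pos x))) (ℕₚ.<⇒≤ (Finₚ.toℕ<n (pos y)))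

  descent : ∀ {i j k l} c₀ c₁ c₂ → SamePair (i , j) (ends c₀) → SamePair (i , k) (ends c₁) → SamePair (j , l) (ends c₂) →
    rank i ≤ rank j → rank j < rank k → rank i < rank l →
    ∃ λ d → Descent ((c₁ , c₂) , (c₀ , d))
  descent {i} {j} {k} {l} c₀ c₁ c₂ ij ik jl i≤j j<k i<l = d ,
    degree⇒sameFiber {var c₁ ⊕ var c₂} {var c₀ ⊕ var d} degrees , inj₁ lighter
    where
    d = joinVar k l
    kl : SamePair (k , l) (ends d)
    kl = ends-variable (exchange i≤j j<k i<l (samePair⇒joinable c₀ ij) (samePair⇒joinable c₁ ik) (samePair⇒joinable c₂ jl))
    lem : ∀ i j k l → (i + k) + (j + l) ≡ (i + j) + (k + l)
    lem = solve-∀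
    degrees : ∀ r → degree (var c₁ ⊕ var c₂) r ≡ degree (var c₀ ⊕ var d) r
    degrees r = begin
      degree (var c₁ ⊕ var c₂) r           ≡⟨ degree-var² c₁ c₂ r ⟩
      incidences c₁ r + incidences c₂ r    ≡⟨ cong₂ _+_ (samePair-incidences c₁ ik r) (samePair-incidences c₂ jl r) ⟩
      (δ i r + δ k r) + (δ j r + δ l r)    ≡⟨ lem (δ i r) (δ j r) (δ k r) (δ l r) ⟩
      (δ i r + δ j r) + (δ k r + δ l r)    ≡⟨ cong₂ _+_ (samePair-incidences c₀ ij r) (samePair-incidences d kl r) ⟨
      incidences c₀ r + incidences d r     ≡⟨ degree-var² c₀ d r ⟨
      degree (var c₀ ⊕ var d) r            ∎
      where open ≡-Reasoning
    lighter : ω (var c₀ ⊕ var d) < ω (var c₁ ⊕ var c₂)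
    lighter = begin-strict
      ω (var c₀ ⊕ var d)        ≡⟨ weighted-var² weight c₀ d ⟩
      weight c₀ + weight d      ≡⟨ cong₂ _+_ (weight-ends c₀ ij) (weight-ends d kl) ⟩
      (n * n ∸ rank i * rank j) + (n * n ∸ rank k * rank l)
        <⟨ complement-< (rank-*-≤ i j) (rank-*-≤ k l) (rank-*-≤ i k) (rank-*-≤ j l) (rearrangement {rank i} {rank j} j<k i<l) ⟩
      (n * n ∸ rank i * rank k) + (n * n ∸ rank j * rank l)
                                ≡⟨ cong₂ _+_ (weight-ends c₁ ik) (weight-ends c₂ jl) ⟨
      weight c₁ + weight c₂     ≡⟨ weighted-var² weight c₁ c₂ ⟨
      ω (var c₁ ⊕ var c₂)       ∎
      where open ℕₚ.≤-Reasoning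

  Differ : Monomial N → Monomial N → Fin N → Set
  Differ u v c = lookup u c ≢ lookup v c

  -- {i, j} is the first edge or loop in which u and v differ, and u has more of it.  Balancing
  -- the degrees at i and at j produces {i, k} and {j, l} in v; when i = j the second comparison
  -- is corrected by the copy of {i, k} already used, so that v contains both together.
  reducible : ∀ {u v i j} c₀ → SameFiber u v → SamePair (i , j) (ends c₀) → lookup v c₀ < lookup u c₀ →
    (∀ {x y} c → Differ u v c → SamePair (x , y) (ends c) → rank i ≤ rank x) →
    (∀ {y} c → Differ u v c → SamePair (i , y) (ends c) → rank j ≤ rank y) → Reducible v
  reducible {u} {v} {i} {j} c₀ u~v ij v<u i-least j-least =
    let c₁ , u<v₁ , k , ik , j<k = first
        c₂ , u<v₂ , l , jl , i<l = second c₁ u<v₁ k ik j<k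
        d , desc = descent c₀ c₁ c₂ ij ik jl (i-least c₀ (ℕₚ.<⇒≢ v<u ∘ sym) (SamePair-swapˡ ij)) j<k i<l
    in ((c₁ , c₂) , (c₀ , d)) , desc , divides c₁ c₂ u<v₁ u<v₂
    where
    ≢c₀ : ∀ {c} → lookup u c < lookup v c → c ≢ c₀
    ≢c₀ lt refl = ℕₚ.<-asym lt v<u

    first : ∃ λ c₁ → lookup u c₁ < lookup v c₁ × ∃ λ k → SamePair (i , k) (ends c₁) × rank j < rank k
    first =
      let c₁ , lt = sum-<⇒∃< (λ c → incidences c i * lookup u c) (λ c → incidences c i * lookup v c)
                      (ℕₚ.≤-reflexive (sameFiber⇒degree {u} {v} u~v i)) c₀ more
          u<v , incident = *-cancelˡ-<′ (incidences c₁ i) lt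
          k , ik = incident⇒end c₁ i incident
      in c₁ , u<v , k , ik , rank-≤∧≢⇒< (j-least c₁ (ℕₚ.<⇒≢ u<v) ik)
           (λ j≡k → ≢c₀ u<v (pair-injective c₁ c₀ ik (subst (λ x → SamePair (i , x) (ends c₀)) j≡k ij)))
      where
      more : incidences c₀ i * lookup v c₀ < incidences c₀ i * lookup u c₀
      more rewrite samePair-incidences c₀ ij i | δ-refl i = ℕₚ.*-monoʳ-< (suc (δ j i)) v<u

    second : ∀ c₁ → lookup u c₁ < lookup v c₁ → ∀ k → SamePair (i , k) (ends c₁) → rank j < rank k →
      ∃ λ c₂ → lookup u c₂ + δ c₁ c₂ < lookup v c₂ × ∃ λ l → SamePair (j , l) (ends c₂) × rank i < rank l
    second c₁ u<v₁ k ik j<k = conclude (sum-<⇒∃< f g (ℕₚ.≤-reflexive sums) c₀ more)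
      where
      -- As `k` differs from `j`, this is one if `i = j` and zero otherwise. The correction charges
      -- the used copy of `c₁` to the side of `u` and balances it at `c₀`, where the inequality in
      -- favour of `u` survives.
      a = incidences c₁ j
      f g : Fin N → ℕ
      f c = incidences c j * lookup u c + a * δ c₁ c
      g c = incidences c j * lookup v c + a * δ c₀ c
      sums : sum f ≡ sum g
      sums = begin
        sum f                               ≡⟨ ∑-distrib-+ (λ c → incidences c j * lookup u c) _ ⟩
        degree u j + sum (λ c → a * δ c₁ c) ≡⟨ cong₂ _+_ (sameFiber⇒degree {u} {v} u~v j) (trans (sum-δ c₁ (λ _ → a)) (sym (sum-δ c₀ (λ _ → a)))) ⟩
        degree v j + sum (λ c → a * δ c₀ c) ≡⟨ ∑-distrib-+ (λ c → incidences c j * lookup v c) _ ⟨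
        sum g                               ∎
        where open ≡-Reasoning
      a≡ : a ≡ δ i j
      a≡ = trans (samePair-incidences c₁ ik j) (trans (cong (λ x → δ i j + x) (δ-≢ (≢-sym (rank-<⇒≢ j<k)))) (ℕₚ.+-identityʳ _))
      c₁≢c₀ : c₁ ≢ c₀
      c₁≢c₀ = ≢c₀ u<v₁
      more : g c₀ < f c₀
      more rewrite samePair-incidences c₀ ij j | a≡ | δ-refl j | δ-refl c₀ | δ-≢ c₁≢c₀ = begin-strict
        (δ i j + 1) * V + δ i j * 1          <⟨ ℕₚ.≤-reflexive (lem (δ i j) V) ⟩
        (δ i j + 1) * suc V                  ≤⟨ ℕₚ.*-monoʳ-≤ (δ i j + 1) v<u ⟩
        (δ i j + 1) * lookup u c₀            ≤⟨ ℕₚ.m≤m+n _ _ ⟩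
        (δ i j + 1) * lookup u c₀ + δ i j * 0 ∎
        where
        open ℕₚ.≤-Reasoning
        V = lookup v c₀
        lem : ∀ d V → suc ((d + 1) * V + d * 1) ≡ (d + 1) * suc V
        lem = solve-∀
      conclude : (∃ λ c₂ → f c₂ < g c₂) →
        ∃ λ c₂ → lookup u c₂ + δ c₁ c₂ < lookup v c₂ × ∃ λ l → SamePair (j , l) (ends c₂) × rank i < rank l
      conclude (c₂ , lt) = finish (c₂ Fin.≟ c₀) (c₁ Fin.≟ c₂)
        where
        finish : Dec (c₂ ≡ c₀) → Dec (c₁ ≡ c₂) → _
        finish (yes refl) _ = contradiction lt (ℕₚ.<-asym more)
        finish (no c₂≢c₀) c₁≟c₂ =
          let lt″ , incident = *-cancelˡ-<′ (incidences c₂ j) (lt′ c₁≟c₂)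
              l , jl = incident⇒end c₂ j incident
              u<v₂ = ℕₚ.≤-<-trans (ℕₚ.m≤m+n _ (δ c₁ c₂)) lt″
          in c₂ , lt″ , l , jl , rank-≤∧≢⇒< (i-least c₂ (ℕₚ.<⇒≢ u<v₂) (SamePair-swapˡ jl))
               (λ i≡l → c₂≢c₀ (pair-injective c₂ c₀ (SamePair-swapˡ jl) (subst (λ x → SamePair (x , j) (ends c₀)) i≡l ij)))
          where
          g≡ : g c₂ ≡ incidences c₂ j * lookup v c₂
          g≡ = trans (cong (λ x → incidences c₂ j * lookup v c₂ + a * x) (δ-≢ (≢-sym c₂≢c₀)))
                 (trans (cong (incidences c₂ j * lookup v c₂ +_) (ℕₚ.*-zeroʳ a)) (ℕₚ.+-identityʳ _))
          lt′ : Dec (c₁ ≡ c₂) → incidences c₂ j * (lookup u c₂ + δ c₁ c₂) < incidences c₂ j * lookup v c₂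
          -- For `c₁ = c₂` the factor `incidences c₂ j` is `a` itself, so the correction amounts to
          -- one more copy that `v` must have.
          lt′ (yes refl) = subst₂ _<_ (sym (ℕₚ.*-distribˡ-+ a (lookup u c₂) (δ c₁ c₂))) g≡ lt
          lt′ (no c₁≢c₂) = ℕₚ.≤-<-trans (ℕₚ.≤-trans (ℕₚ.≤-reflexive
            (cong (incidences c₂ j *_) (trans (cong (lookup u c₂ +_) (δ-≢ c₁≢c₂)) (ℕₚ.+-identityʳ _))))
            (ℕₚ.m≤m+n _ (a * δ c₁ c₂))) (subst (f c₂ <_) g≡ lt)

    divides : ∀ c₁ c₂ → lookup u c₁ < lookup v c₁ → lookup u c₂ + δ c₁ c₂ < lookup v c₂ → (var c₁ ⊕ var c₂) ∣ₘ v
    divides c₁ c₂ lt₁ lt₂ r = subst (_≤ lookup v r)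
      (sym (trans (lookup-⊕ (var c₁) (var c₂) r) (cong₂ _+_ (lookup-var c₁ r) (lookup-var c₂ r)))) (bound (c₂ Fin.≟ r) (c₁ Fin.≟ r))
      where
      bound : Dec (c₂ ≡ r) → Dec (c₁ ≡ r) → δ c₁ r + δ c₂ r ≤ lookup v r
      bound (yes refl) _ rewrite δ-refl c₂ = ℕₚ.≤-trans (ℕₚ.≤-reflexive (ℕₚ.+-comm (δ c₁ c₂) 1)) (ℕₚ.≤-trans (s≤s (ℕₚ.m≤n+m _ (lookup u c₂))) lt₂)
      bound (no c₂≢r) (yes refl) rewrite δ-refl c₁ | δ-≢ c₂≢r = ℕₚ.≤-trans (s≤s z≤n) lt₁
      bound (no c₂≢r) (no c₁≢r) rewrite δ-≢ c₁≢r | δ-≢ c₂≢r = z≤n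

  differ? : ∀ u v → Decidable (Differ u v)
  differ? u v c = ¬? (lookup u c ℕ.≟ lookup v c)

  -- Minimizing over one end and then over the other finds the first edge or loop in which the
  -- monomials differ. The monomial with fewer copies of it is the reducible one.
  fiber-reducible : ∀ u v → SameFiber u v → u ≢ v → Reducible u ⊎ Reducible v
  fiber-reducible u v u~v u≢v
    with Finₚ.any? (differ? u v)
  ... | no none = contradiction (≗⇒≡ λ c → decidable-stable (lookup u c ℕ.≟ lookup v c) λ d → none (c , d)) u≢v
  ... | yes (c , differ)
    with i , (c′ , differ′ , j′ , ij′) , i-least ← least
           (λ x → Finₚ.any? λ c → differ? u v c ×-dec Finₚ.any? λ y → samePair? (x , y) (ends c))
           rank (_ , c , differ , _ , inj₁ (refl , refl))
    with j , (c₀ , differ₀ , ij) , j-least ← least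
           (λ y → Finₚ.any? λ c → differ? u v c ×-dec samePair? (i , y) (ends c)) rank (j′ , c′ , differ′ , ij′)
    with ℕₚ.<-cmp (lookup u c₀) (lookup v c₀)
  ... | tri≈ _ eq _ = contradiction eq differ₀
  ... | tri> _ _ v<u = inj₂ (reducible {u} {v} c₀ u~v ij v<u
        (λ c d p → i-least (c , d , _ , p)) (λ c d p → j-least (c , d , p)))
  ... | tri< u<v _ _ = inj₁ (reducible {v} {u} c₀ (sameFiber-sym {u} {v} u~v) ij u<v
        (λ c d p → i-least (c , ≢-sym d , _ , p)) (λ c d p → j-least (c , ≢-sym d , p)))

  hasQuadraticBasis : Toric.HasQuadraticGroebnerBasis K (extendedIncidence G)
  hasQuadraticBasis = hasQuadraticGroebnerBasis fiber-reducible

theorem2p2 : ∀ {c ℓ} (K : Field c ℓ) (n : ℕ) (G : SimpleGraph n) →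
    let open Toric K (extendedIncidence G) in
    (StronglyChordal G ⇔ HasQuadraticGroebnerBasis) ×
    (HasQuadraticGroebnerBasis ⇔ GeneratedByQuadraticBinomials)
theorem2p2 K n G =
  mk⇔ chordal⇒groebner (connected⇒stronglyChordal G ∘ groebner⇒connected) ,
  mk⇔ (connected⇒generated ∘ groebner⇒connected)
      (chordal⇒groebner ∘ connected⇒stronglyChordal G ∘ generated⇒connected)
  where
  open ToricConnectivity K (extendedIncidence G)
  chordal⇒groebner : StronglyChordal G → Toric.HasQuadraticGroebnerBasis K (extendedIncidence G)
  chordal⇒groebner (σ , peo) = ChordalGroebner.hasQuadraticBasis K G σ peo
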